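{- Let $\mathcal H$ be a class of colored graphs. The following statements are equivalent: (1) There is a constant $c$ such that for every $H\in\mathcal H$, every graph in $\mathrm{Spasm}(H)$ has treewidth at most $c$. (2) There is a constant $c$ such that for every $H\in\mathcal H$, the graph $\widehat H$ has treewidth at most $c$ and there is no $c$-flower centered at any color class of $H$. (3) There is a constant $c$ such that for every $H\in\mathcal H$ there is a guarded cutvertex decomposition of $H$ with guard size at most $c$ whose bags each contain vertices of at most $c$ colors.
   Context: A colored graph is a finite simple graph $H$ with a (not necessarily proper) vertex coloring; the color classes are $C_i$. $\mathrm{Spasm}(H)$ is the set of (colored) graphs obtained from $H$ by choosing a partition of $V(H)$ in which each block is a monochromatic independent set and identifying each block into a single vertex of that color. $\widehat H$ is the simple graph with one vertex $v_i$ per color class $C_i$, with $v_iv_j$ an edge iff $H$ has an edge between $C_i$ and $C_j$. $H^{\bullet}$ is obtained from $H$ by making every color class a clique; $H^{\bullet\setminus i}$ is obtained from $H$ by making every color class except $C_i$ a clique. A $c$-flower centered at class $C_i$ is a collection of $c$ pairwise vertex-disjoint paths of length at least $1$ in $H^{\bullet\setminus i}$, each having both endpoints in $C_i$. For a rooted tree decomposition $(T,\beta)$, let $\sigma(t)=\beta(t)\cap\beta(s)$ where $s$ is the parent of $t$ ($\sigma(\text{root})=\emptyset$). A guarded cutvertex decomposition of $H$ is a triple $(T,\beta,g)$ where $(T,\beta)$ is a rooted tree decomposition of $H^{\bullet}$ and $g:V(T)\to2^{V(H)}$ satisfies $\sigma(t)\subseteq g(t)\subseteq\beta(t)$, such that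 (i) for every $t$, $g(t)$ is a vertex cover of $H[\beta(t)]$, and (ii) for every $t$ and every child $t'$ of $t$, $|\sigma(t')\setminus g(t)|\le1$. Its guard size is $\max_t|g(t)|$. -}

module Defs where

open import Data.Nat using (ℕ; zero; suc; _≤_; _+_)
open import Data.Fin using (Fin; zero; suc; toℕ; inject₁; fromℕ)
open import Data.Fin.Subset using (Subset; _∈_; _⊆_; _∩_; _─_; ∣_∣; ⊥)
open import Data.Bool using (Bool; true; false)
open import Data.Product using (Σ; ∃; ∃-syntax; _×_; _,_)
open import Data.Sum using (_⊎_)
open import Relation.Binary.PropositionalEquality using (_≡_; _≢_)
open import Relation.Nullary using (¬_)
open import Relation.Binary.Construct.Closure.ReflexiveTransitive using (Star)

record CGraph : Set where
  field
    n    : ℕ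
    adj  : Fin n → Fin n → Bool
    sym  : ∀ u v → adj u v ≡ adj v u
    irr  : ∀ v → adj v v ≡ false
    k    : ℕ
    col  : Fin n → Fin k

Rel : ℕ → Set₁
Rel n = Fin n → Fin n → Set

-- Rooted trees: nodes Fin (suc m), root = zero, and node (suc i) has
-- parent par i whose index is at most i (i.e. strictly smaller than suc i).
-- Every finite rooted tree can be presented this way.

record RTree : Set where
  field
    m      : ℕ
    par    : Fin m → Fin (suc m)
    par-lt : ∀ i → toℕ (par i) ≤ toℕ i

data TAdj (T : RTree) : Fin (suc (RTree.m T)) → Fin (suc (RTree.m T)) → Set where
  up   : ∀ i → TAdj T (suc i) (RTree.par T i)
  down : ∀ i → TAdj T (RTree.par T i) (suc i)

sigma : ∀ {n} (T : RTree) → (Fin (suc (RTree.m T)) → Subset n)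
      → Fin (suc (RTree.m T)) → Subset n
sigma T β zero    = ⊥
sigma T β (suc i) = β (suc i) ∩ β (RTree.par T i)

record TreeDec (n : ℕ) (E : Rel n) : Set where
  field
    tree  : RTree
    bag   : Fin (suc (RTree.m tree)) → Subset n
  Node : Set
  Node = Fin (suc (RTree.m tree))
  field
    vcover : ∀ v → ∃[ t ] v ∈ bag t
    ecover : ∀ u v → E u v → ∃[ t ] (u ∈ bag t × v ∈ bag t)
    conn   : ∀ v s t → v ∈ bag s → v ∈ bag t →
             Star (λ a b → TAdj tree a b × v ∈ bag a × v ∈ bag b) s t

TwAtMost : (n : ℕ) → Rel n → ℕ → Set
TwAtMost n E c = Σ (TreeDec n E) λ D → ∀ t → ∣ TreeDec.bag D t ∣ ≤ suc c

module _ (H : CGraph) where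
  open CGraph H

  Edge : Rel n
  Edge u v = adj u v ≡ true

  EdgeBullet : Rel n
  EdgeBullet u v = Edge u v ⊎ (u ≢ v × col u ≡ col v)

  EdgeBulletExcept : Fin k → Rel n
  EdgeBulletExcept i u v = Edge u v ⊎ (u ≢ v × col u ≡ col v × col u ≢ i)

  HatEdge : Rel k
  HatEdge i j = i ≢ j × ∃[ u ] ∃[ v ] (col u ≡ i × col v ≡ j × Edge u v)

  -- Spasm: a partition of V(H) into monochromatic independent blocks is
  -- given by a surjection f : Fin n → Fin m (blocks = fibres);
  -- the resulting graph has vertex set Fin m.
  record SpasmMap (m : ℕ) : Set where
    field
      f      : Fin n → Fin m
      surj   : ∀ b → ∃[ v ] f v ≡ b
      mono   : ∀ u v → f u ≡ f v → col u ≡ col v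
      indep  : ∀ u v → f u ≡ f v → ¬ Edge u v

  QuotEdge : ∀ {m} → SpasmMap m → Rel m
  QuotEdge σ a b = ∃[ u ] ∃[ v ] (SpasmMap.f σ u ≡ a × SpasmMap.f σ v ≡ b × Edge u v)

  -- c-flower centered at class C_i: c pairwise vertex-disjoint paths of
  -- length ≥ 1 in H^{•∖i}, both endpoints in C_i.  Path a has vertices
  -- p a 0, …, p a (suc (len a)), all distinct.
  record Flower (c : ℕ) (i : Fin k) : Set where
    field
      len     : Fin c → ℕ
      p       : (a : Fin c) → Fin (suc (suc (len a))) → Fin n
      step    : ∀ a (j : Fin (suc (len a))) →
                EdgeBulletExcept i (p a (inject₁ j)) (p a (suc j))
      start   : ∀ a → col (p a zero) ≡ i
      end     : ∀ a → col (p a (fromℕ (suc (len a)))) ≡ i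
      inj     : ∀ a b j j' → p a j ≡ p b j' → a ≡ b
      injPath : ∀ a j j' → p a j ≡ p a j' → j ≡ j'

  record GuardedDec (c : ℕ) : Set where
    field
      dec   : TreeDec n EdgeBullet
    open TreeDec dec public
    field
      g       : Node → Subset n
      σ⊆g     : ∀ t → sigma tree bag t ⊆ g t
      g⊆β     : ∀ t → g t ⊆ bag t
      vc      : ∀ t u v → u ∈ bag t → v ∈ bag t → Edge u v → u ∈ g t ⊎ v ∈ g t
      cutv    : ∀ i → ∣ sigma tree bag (suc i) ─ g (RTree.par tree i) ∣ ≤ 1
      guard   : ∀ t → ∣ g t ∣ ≤ c
      colors  : ∀ t → ∃[ S ] (∣ S ∣ ≤ c × (∀ v → v ∈ bag t → col v ∈ S))

Cond1 : (CGraph → Set) → Set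
Cond1 𝓗 = ∃[ c ] ∀ H → 𝓗 H → ∀ m (s : SpasmMap H m) → TwAtMost m (QuotEdge H s) c

Cond2 : (CGraph → Set) → Set
Cond2 𝓗 = ∃[ c ] ∀ H → 𝓗 H →
  TwAtMost (CGraph.k H) (HatEdge H) c × (∀ i → ¬ Flower H c i)

Cond3 : (CGraph → Set) → Set
Cond3 𝓗 = ∃[ c ] ∀ H → 𝓗 H → GuardedDec H c

{-# OPTIONS --safe #-}
module Submission where

-- (1)⇒(2): identifying nonadjacent vertices of equal colour inside each branch set as long
-- as possible turns a minor model in H^• into a minor model in a member of Spasm(H). The colour
-- classes model Ĥ, and the petals of a flower with q² petals model K_q.
--
-- (2)⇒(3): growing a subcubic forest with leaves in C_i gives either c disjoint C_i-paths in
-- H^{•∖i} or a bounded set X_i hitting them all. A vertex x of X_i whose colour shares no bag with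
-- i in the tree decomposition of Ĥ is replaced by the vertices of C_i in whose component x is
-- seen: they have colour-disjoint connections to x, each crossing one bag that separates i from the
-- colour of x, so there are few. Then the sets ⋃_{i ∈ B(t)} (C_i ∪ X_i) form a tree decomposition of
-- H^•. Outside the sets X_i, distinct vertices of C_i are in distinct components, and at most one
-- of them shares its component with C_j; adding these vertices for i, j ∈ B(t) yields a bounded
-- vertex cover of the bag such that every component hanging below it has at most one further
-- neighbour in the bag. Splitting the decomposition into components gives the guards.
--
-- (3)⇒(1): replace the bag of t in a quotient by the blocks meeting g(t), and give each remaining
-- block of the bag a leaf of its own; each child subtree fits at one leaf by condition (ii).

open import Defs
open import Data.Bool using (true; false)
import Data.Bool.Properties as Bool
open import Data.Nat as ℕ using (ℕ; zero; suc; _≤_; _<_; _+_; _*_; z≤n; s≤s)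
import Data.Nat.Properties as ℕ
open import Data.Nat.Tactic.RingSolver using (solve-∀)
open import Data.Nat.Induction using (<-wellFounded)
open import Induction.WellFounded using (Acc; acc)
open import Data.Fin as Fin using (Fin; zero; suc; toℕ; inject₁; fromℕ; combine; remQuot; punchIn; punchOut)
import Data.Fin.Properties as Fin
open import Data.Fin.Induction using (<-weakInduction)
open import Data.Fin.Subset as Subset using (Subset; ∣_∣; ⁅_⁆; _∪_; _─_)
  renaming (_∈_ to _∈ˢ_; _⊆_ to _⊆ˢ_; ⊥ to ∅)
import Data.Fin.Subset.Properties as Subset
open import Data.List as List using (List; []; _∷_; length)
import Data.List.Properties as List
open import Data.List.Membership.Propositional using (_∈_)
import Data.List.Membership.Propositional.Properties as ∈
import Data.List.Membership.Setoid.Properties as ∈ using (index-injective)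
import Data.List.Membership.DecPropositional as DecMembership
open import Data.List.Relation.Unary.Any using (here; there)
open import Data.List.Relation.Unary.All as All using (All; []; _∷_)
import Data.List.Relation.Unary.All.Properties as All
open import Data.List.Relation.Unary.AllPairs as AllPairs using (AllPairs; []; _∷_)
import Data.List.Relation.Unary.AllPairs.Properties as AllPairs
open import Data.Vec as Vec using ([]; _∷_)
import Data.Vec.Properties as Vec
open import Data.Maybe as Maybe using (Maybe; just; nothing)
import Data.Maybe.Properties as Maybe
open import Data.Product using (Σ; ∃; ∃-syntax; _×_; _,_; proj₁; proj₂)
open import Data.Sum using (_⊎_; inj₁; inj₂; [_,_]′)
open import Data.Empty using (⊥)
open import Function using (_∘_; id; case_of_)
open import Function.Bundles using (_⇔_; mk⇔)
open import Relation.Unary using (Decidable)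
open import Relation.Nullary using (Dec; yes; no; ¬_; does; contradiction)
open import Relation.Nullary.Decidable using (_×-dec_; _⊎-dec_; ¬?; map′; decidable-stable)
open import Relation.Binary.PropositionalEquality
open import Relation.Binary.Construct.Closure.ReflexiveTransitive as Star using (Star; ε; _◅_; _◅◅_)

-- Finite sets

-- A cardinality bound witnessed by a list that may contain repetitions and elements outside `P`; so
-- it passes to subsets and unions without deciding `P`.
AtMost : {A : Set} → ℕ → (A → Set) → Set
AtMost k P = ∃[ xs ] (length xs ≤ k × (∀ {v} → P v → v ∈ xs))

atMost-mono : ∀ {A : Set} {P Q : A → Set} {k l} → k ≤ l → (∀ {v} → Q v → P v) → AtMost k P → AtMost l Q
atMost-mono k≤l Q⇒P (xs , ∣xs∣≤k , P⇒xs) = xs , ℕ.≤-trans ∣xs∣≤k k≤l , P⇒xs ∘ Q⇒P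

atMost-none : ∀ {A : Set} {P : A → Set} {k} → (∀ {v} → ¬ P v) → AtMost k P
atMost-none ¬P = [] , z≤n , λ p → contradiction p ¬P

atMost-point : ∀ {A : Set} (x : A) → AtMost 1 (λ v → v ≡ x)
atMost-point x = x ∷ [] , ℕ.≤-refl , here

atMost-unique : ∀ {n} {P : Fin n → Set} → Decidable P → (∀ {u v} → P u → P v → u ≡ v) → AtMost 1 P
atMost-unique P? unique with Fin.any? P?
... | yes (x , px) = x ∷ [] , ℕ.≤-refl , λ pv → here (unique pv px)
... | no ∄ = atMost-none (λ {v} pv → ∄ (v , pv))

atMost-∪ : ∀ {A : Set} {P Q : A → Set} {k l} → AtMost k P → AtMost l Q → AtMost (k + l) (λ v → P v ⊎ Q v)
atMost-∪ (xs , ∣xs∣≤ , P⇒) (ys , ∣ys∣≤ , Q⇒) =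
  xs List.++ ys ,
  ℕ.≤-trans (ℕ.≤-reflexive (List.length-++ xs)) (ℕ.+-mono-≤ ∣xs∣≤ ∣ys∣≤) ,
  [ ∈.∈-++⁺ˡ ∘ P⇒ , ∈.∈-++⁺ʳ xs ∘ Q⇒ ]′

atMost-⋃ : ∀ {A B : Set} {P : A → Set} {Q : A → B → Set} {k l} →
           AtMost k P → (∀ d → AtMost l (Q d)) → AtMost (k * l) (λ v → ∃[ d ] (P d × Q d v))
atMost-⋃ {Q = Q} {l = l} (xs , ∣xs∣≤k , P⇒) few with union xs
  where
  union : ∀ xs → AtMost (length xs * l) (λ v → ∃[ d ] (d ∈ xs × Q d v))
  union [] = atMost-none λ { (_ , () , _) }
  union (x ∷ xs) = atMost-mono ℕ.≤-refl
    (λ { (_ , here refl , q) → inj₁ q ; (d , there d∈ , q) → inj₂ (d , d∈ , q) })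
    (atMost-∪ (few x) (union xs))
... | covered = atMost-mono (ℕ.*-monoˡ-≤ l ∣xs∣≤k) (λ (d , p , q) → d , P⇒ p , q) covered

atMost-⋃₁ : ∀ {A B : Set} {P : A → Set} {Q : A → B → Set} {k} →
            AtMost k P → (∀ d → AtMost 1 (Q d)) → AtMost k (λ v → ∃[ d ] (P d × Q d v))
atMost-⋃₁ {k = k} p q = atMost-mono (ℕ.≤-reflexive (ℕ.*-identityʳ k)) id (atMost-⋃ p q)

atMost-Fin : ∀ {k q} → AtMost k (λ (x : Fin q) → x ≡ x) → q ≤ k
atMost-Fin (xs , ∣xs∣≤k , all∈) = ℕ.≤-trans
  (Fin.injective⇒≤ (λ {i} {j} → ∈.index-injective (setoid _) (all∈ {i} refl) (all∈ {j} refl))) ∣xs∣≤k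

elements : ∀ {n} → Subset n → List (Fin n)
elements [] = []
elements (true ∷ S) = zero ∷ List.map suc (elements S)
elements (false ∷ S) = List.map suc (elements S)

∣elements∣ : ∀ {n} (S : Subset n) → length (elements S) ≡ ∣ S ∣
∣elements∣ [] = refl
∣elements∣ (true ∷ S) = cong suc (trans (List.length-map suc (elements S)) (∣elements∣ S))
∣elements∣ (false ∷ S) = trans (List.length-map suc (elements S)) (∣elements∣ S)

∈-elements : ∀ {n} {v} (S : Subset n) → v ∈ˢ S → v ∈ elements S
∈-elements (true ∷ S) Vec.here = here refl
∈-elements (true ∷ S) (Vec.there v∈S) = there (∈.∈-map⁺ suc (∈-elements S v∈S))
∈-elements (false ∷ S) (Vec.there v∈S) = ∈.∈-map⁺ suc (∈-elements S v∈S)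

∣∣≤⇒atMost : ∀ {n k} (S : Subset n) → ∣ S ∣ ≤ k → AtMost k (_∈ˢ S)
∣∣≤⇒atMost S ∣S∣≤k = elements S , ℕ.≤-trans (ℕ.≤-reflexive (∣elements∣ S)) ∣S∣≤k , ∈-elements S

∣∪∣≤ : ∀ {n} (p q : Subset n) → ∣ p ∪ q ∣ ≤ ∣ p ∣ + ∣ q ∣
∣∪∣≤ [] [] = z≤n
∣∪∣≤ (true ∷ p) (true ∷ q) = s≤s (ℕ.≤-trans (∣∪∣≤ p q) (ℕ.+-monoʳ-≤ ∣ p ∣ (ℕ.n≤1+n _)))
∣∪∣≤ (true ∷ p) (false ∷ q) = s≤s (∣∪∣≤ p q)
∣∪∣≤ (false ∷ p) (true ∷ q) = ℕ.≤-trans (s≤s (∣∪∣≤ p q)) (ℕ.≤-reflexive (sym (ℕ.+-suc ∣ p ∣ ∣ q ∣)))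
∣∪∣≤ (false ∷ p) (false ∷ q) = ∣∪∣≤ p q

atMost⇒∣∣≤ : ∀ {n k} (S : Subset n) → AtMost k (_∈ˢ S) → ∣ S ∣ ≤ k
atMost⇒∣∣≤ {n} S (xs , ∣xs∣≤k , S⇒) = ℕ.≤-trans
  (ℕ.≤-trans (Subset.p⊆q⇒∣p∣≤∣q∣ (∈⋃ xs ∘ S⇒)) (∣⋃∣≤ xs)) ∣xs∣≤k
  where
  ⋃ : List (Fin n) → Subset n
  ⋃ [] = ∅
  ⋃ (x ∷ xs) = ⁅ x ⁆ ∪ ⋃ xs
  ∈⋃ : ∀ {v} xs → v ∈ xs → v ∈ˢ ⋃ xs
  ∈⋃ (x ∷ xs) (here refl) = Subset.x∈p∪q⁺ (inj₁ (Subset.x∈⁅x⁆ x))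
  ∈⋃ (x ∷ xs) (there v∈) = Subset.x∈p∪q⁺ (inj₂ (∈⋃ xs v∈))
  ∣⋃∣≤ : ∀ xs → ∣ ⋃ xs ∣ ≤ length xs
  ∣⋃∣≤ [] = ℕ.≤-reflexive (Subset.∣⊥∣≡0 n)
  ∣⋃∣≤ (x ∷ xs) = ℕ.≤-trans (∣∪∣≤ ⁅ x ⁆ (⋃ xs)) (ℕ.+-mono-≤ (ℕ.≤-reflexive (Subset.∣⁅x⁆∣≡1 x)) (∣⋃∣≤ xs))

⟪_⟫ : ∀ {n} {P : Fin n → Set} → Decidable P → Subset n
⟪ P? ⟫ = Vec.tabulate (does ∘ P?)

∈⟪⟫⁺ : ∀ {n} {P : Fin n → Set} (P? : Decidable P) {v} → P v → v ∈ˢ ⟪ P? ⟫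
∈⟪⟫⁺ P? {v} pv = Vec.lookup⇒[]= v _ (trans (Vec.lookup∘tabulate _ v) (holds (P? v)))
  where
  holds : (d : Dec _) → does d ≡ true
  holds (yes _) = refl
  holds (no ¬pv) = contradiction pv ¬pv

∈⟪⟫⁻ : ∀ {n} {P : Fin n → Set} (P? : Decidable P) {v} → v ∈ˢ ⟪ P? ⟫ → P v
∈⟪⟫⁻ P? {v} v∈ = holds (P? v) (trans (sym (Vec.lookup∘tabulate _ v)) (Vec.[]=⇒lookup v∈))
  where
  holds : ∀ {A} (d : Dec A) → does d ≡ true → A
  holds (yes a) _ = a

∣⟪⟫∣≤ : ∀ {n k} {P : Fin n → Set} (P? : Decidable P) → AtMost k P → ∣ ⟪ P? ⟫ ∣ ≤ k
∣⟪⟫∣≤ P? few = atMost⇒∣∣≤ ⟪ P? ⟫ (atMost-mono ℕ.≤-refl (∈⟪⟫⁻ P?) few)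

abstract
  argmin : ∀ {n} {P : Fin n → Set} → Decidable P → (f : Fin n → ℕ) → ∃ P →
           ∃[ w ] (P w × ∀ v → P v → f w ≤ f v)
  argmin {n} {P} P? f (v , pv) = search v pv (<-wellFounded (f v))
    where
    search : ∀ v → P v → Acc _<_ (f v) → ∃[ w ] (P w × ∀ v → P v → f w ≤ f v)
    search v pv (acc smaller) with Fin.any? (λ w → P? w ×-dec (f w ℕ.<? f v))
    ... | yes (w , pw , fw<fv) = search w pw (smaller fw<fv)
    ... | no ∄ = v , pv , λ w pw → ℕ.≮⇒≥ (λ fw<fv → ∄ (w , pw , fw<fv))

-- Reachability in finite graphs

data Path {A : Set} (R : A → A → Set) : A → A → ℕ → Set where
  [_]  : ∀ x → Path R x x 0
  _∷_ : ∀ {x y z l} → R x y → Path R y z l → Path R x z (suc l)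

module _ {A : Set} {R : A → A → Set} where

  at : ∀ {x y l} → Path R x y l → Fin (suc l) → A
  at {x} p zero = x
  at (r ∷ p) (suc j) = at p j

  at-first : ∀ {x y l} (p : Path R x y l) → at p zero ≡ x
  at-first [ x ] = refl
  at-first (r ∷ p) = refl

  at-last : ∀ {x y l} (p : Path R x y l) → at p (fromℕ l) ≡ y
  at-last [ x ] = refl
  at-last (r ∷ p) = at-last p

  at-step : ∀ {x y l} (p : Path R x y (suc l)) j → R (at p (inject₁ j)) (at p (suc j))
  at-step (r ∷ p) zero = r
  at-step (r ∷ (r' ∷ p)) (suc j) = at-step (r' ∷ p) j

  Simple : ∀ {x y l} → Path R x y l → Set
  Simple p = ∀ i j → at p i ≡ at p j → i ≡ j

  suffix : ∀ {x z l} (p : Path R x z l) → Simple p → ∀ j →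
           ∃[ l' ] Σ (Path R (at p j) z l') Simple
  suffix p simple zero = _ , p , simple
  suffix (r ∷ p) simple (suc j) = suffix p (λ i i' eq → Fin.suc-injective (simple (suc i) (suc i') eq)) j

  -- Loops are cut from the front: if the new first vertex already lies on the simple path for the
  -- rest, only the suffix from it is kept.
  Star⇒simplePath : (∀ (x y : A) → Dec (x ≡ y)) → ∀ {x y} → Star R x y → ∃[ l ] Σ (Path R x y l) Simple
  Star⇒simplePath _≟_ ε = 0 , [ _ ] , λ { zero zero _ → refl }
  Star⇒simplePath _≟_ {x} (r ◅ rs) with Star⇒simplePath _≟_ rs
  ... | l , p , simple with Fin.any? (λ j → at p j ≟ x)
  ...   | yes (j , refl) = suffix p simple j
  ...   | no ∄ = suc l , r ∷ p , simple'
    where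
    simple' : Simple (r ∷ p)
    simple' zero zero _ = refl
    simple' zero (suc j) eq = contradiction (j , sym eq) ∄
    simple' (suc i) zero eq = contradiction (i , eq) ∄
    simple' (suc i) (suc j) eq = cong suc (simple i j eq)

  Path⇒Star : ∀ {x y l} → Path R x y l → Star R x y
  Path⇒Star [ x ] = ε
  Path⇒Star (r ∷ p) = r ◅ Path⇒Star p

module _ {n : ℕ} {R : Fin n → Fin n → Set} (R? : ∀ u v → Dec (R u v)) where

  path? : ∀ l u v → Dec (Path R u v l)
  path? zero u v = map′ (λ { refl → [ u ] }) (λ { [ _ ] → refl }) (u Fin.≟ v)
  path? (suc l) u v = map′ (λ (_ , r , p) → r ∷ p) (λ { (r ∷ p) → _ , r , p })
                           (Fin.any? (λ w → R? u w ×-dec path? l w v))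

  -- A simple path visits at most `n` vertices, so only lengths below `n` need to be tried.
  star? : ∀ u v → Dec (Star R u v)
  star? u v = map′ (λ (_ , p) → Path⇒Star p) bounded (Fin.any? (λ (l : Fin n) → path? (toℕ l) u v))
    where
    bounded : Star R u v → ∃[ l ] Path R u v (toℕ l)
    bounded rs with Star⇒simplePath Fin._≟_ rs
    ... | l , p , simple = Fin.fromℕ< l<n , subst (Path R u v) (sym (Fin.toℕ-fromℕ< l<n)) p
      where
      l<n : l < n
      l<n = Fin.injective⇒≤ {f = at p} (simple _ _)

-- Rooted tree decompositions

open RTree using (m; par; par-lt)

Node : RTree → Set
Node T = Fin (suc (m T))

-- The index is the lower node: it lies in the subtree rooted at `s`.
data Desc (T : RTree) (s : Node T) : Node T → Set where
  self  : Desc T s s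
  child : ∀ {i} → Desc T s (par T i) → Desc T s (suc i)

module _ {T : RTree} where

  Desc-trans : ∀ {r s t} → Desc T r s → Desc T s t → Desc T r t
  Desc-trans rs self = rs
  Desc-trans rs (child st) = child (Desc-trans rs st)

  Desc⇒≤ : ∀ {s t} → Desc T s t → toℕ s ≤ toℕ t
  Desc⇒≤ self = ℕ.≤-refl
  Desc⇒≤ (child {i} st) = ℕ.≤-trans (Desc⇒≤ st) (ℕ.m≤n⇒m≤1+n (par-lt T i))

  Desc? : ∀ s t → Dec (Desc T s t)
  Desc? s t = go t (<-wellFounded (toℕ t))
    where
    go : ∀ t → Acc _<_ (toℕ t) → Dec (Desc T s t)
    go t a with s Fin.≟ t
    go t a | yes refl = yes self
    go zero a | no s≢t = no λ { self → s≢t refl }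
    go (suc i) (acc smaller) | no s≢t =
      map′ child (λ { self → contradiction refl s≢t ; (child d) → d }) (go (par T i) (smaller (s≤s (par-lt T i))))

-- The bags containing v form a subtree rooted at top v; stating this locally
-- (climbing from any other such bag stays inside) makes it easy to establish.
record TopDec (n : ℕ) : Set₁ where
  field
    tree  : RTree
    bag   : Node tree → Fin n → Set
    bag?  : ∀ t → Decidable (bag t)
    top   : Fin n → Node tree
    top∈  : ∀ v → bag (top v) v
    climb : ∀ {v t} → bag t v → t ≢ top v → ∃[ i ] (t ≡ suc i × bag (par tree i) v)

  Touch : Fin n → Fin n → Set
  Touch u v = ∃[ t ] (bag t u × bag t v)

  touch-refl : ∀ v → Touch v v
  touch-refl v = top v , top∈ v , top∈ v

  touch-sym : ∀ {u v} → Touch u v → Touch v u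
  touch-sym (t , u∈ , v∈) = t , v∈ , u∈

  touch? : ∀ u v → Dec (Touch u v)
  touch? u v = Fin.any? (λ t → bag? t u ×-dec bag? t v)

  bag⇒Desc : ∀ {v t} → bag t v → Desc tree (top v) t
  bag⇒Desc {v} {t} = go t (<-wellFounded (toℕ t))
    where
    go : ∀ t → Acc _<_ (toℕ t) → bag t v → Desc tree (top v) t
    go t (acc smaller) v∈ with t Fin.≟ top v
    ... | yes refl = self
    ... | no t≢ with climb v∈ t≢
    ...   | i , refl , v∈' = child (go (par tree i) (smaller (s≤s (par-lt tree i))) v∈')

  top-≤ : ∀ {v t} → bag t v → toℕ (top v) ≤ toℕ t
  top-≤ v∈ = Desc⇒≤ (bag⇒Desc v∈)

  -- As `top v` lies outside the subtree of `s`, `climb` applies at each node on the way from `t` up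
  -- to `s`, and once more at `s`.
  leave : ∀ {v s t} → bag t v → Desc tree s t → ¬ Desc tree s (top v) →
          bag s v × ∃[ i ] (s ≡ suc i × bag (par tree i) v)
  leave {v} {s} v∈ self out = v∈ , climb v∈ (λ eq → out (subst (Desc tree s) eq self))
  leave {v} {s} v∈ (child {i} st) out with climb v∈ (λ eq → out (subst (Desc tree s) eq (child st)))
  ... | _ , refl , v∈' = leave v∈' st out

  -- If `top v` is not below `top u`, the way from the common node up to `top v` passes through
  -- `top u`; likewise with the roles exchanged. Otherwise the two tops coincide.
  helly : ∀ {u v} → Touch u v → bag (top u) v ⊎ bag (top v) u
  helly {u} {v} (t , u∈ , v∈) with Desc? (top u) (top v)
  ... | no out = inj₁ (proj₁ (leave v∈ (bag⇒Desc u∈) out))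
  ... | yes uv with Desc? (top v) (top u)
  ...   | no out = inj₂ (proj₁ (leave u∈ (bag⇒Desc v∈) out))
  ...   | yes vu = inj₁ (subst (λ s → bag s v) (Fin.toℕ-injective (ℕ.≤-antisym (Desc⇒≤ vu) (Desc⇒≤ uv))) (top∈ v))

  module _ {E : Rel n} (cover : ∀ u v → E u v → Touch u v) where

    toTreeDec : TreeDec n E
    toTreeDec = record
      { tree = tree ; bag = bagˢ
      ; vcover = λ v → top v , ∈⟪⟫⁺ (bag? (top v)) (top∈ v)
      ; ecover = λ u v e → let t , u∈ , v∈ = cover u v e in t , ∈⟪⟫⁺ (bag? t) u∈ , ∈⟪⟫⁺ (bag? t) v∈
      ; conn = λ v s t s∋v t∋v → toTop v s s∋v ◅◅ Star.reverse flip (toTop v t t∋v)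
      }
      where
      bagˢ : Node tree → Subset n
      bagˢ t = ⟪ bag? t ⟫
      Adj : Fin n → Node tree → Node tree → Set
      Adj v a b = TAdj tree a b × v ∈ˢ bagˢ a × v ∈ˢ bagˢ b
      flip : ∀ {v a b} → Adj v a b → Adj v b a
      flip (up i , a∋v , b∋v) = down i , b∋v , a∋v
      flip (down i , a∋v , b∋v) = up i , b∋v , a∋v
      toTop : ∀ v t → v ∈ˢ bagˢ t → Star (Adj v) t (top v)
      toTop v t = go t (<-wellFounded (toℕ t))
        where
        go : ∀ t → Acc _<_ (toℕ t) → v ∈ˢ bagˢ t → Star (Adj v) t (top v)
        go t (acc smaller) t∋v with t Fin.≟ top v
        ... | yes refl = ε
        ... | no t≢ with climb (∈⟪⟫⁻ (bag? t) t∋v) t≢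
        ...   | i , refl , v∈ = (up i , t∋v , p∋v) ◅ go (par tree i) (smaller (s≤s (par-lt tree i))) p∋v
          where
          p∋v : v ∈ˢ bagˢ (par tree i)
          p∋v = ∈⟪⟫⁺ (bag? (par tree i)) v∈

    twAtMost : ∀ {c} → (∀ t → AtMost (suc c) (bag t)) → TwAtMost n E c
    twAtMost small = toTreeDec , λ t → ∣⟪⟫∣≤ (bag? t) (small t)

-- The top of `v` is its bag of least index, so it is below no other bag of `v`. A walk to it from
-- `suc i` through bags of `v` leaves the subtree of `suc i`, which is possible only along the edge
-- to the parent.
fromTreeDec : ∀ {n E} → TreeDec n E → TopDec n
fromTreeDec {n} D = record
  { tree = tree
  ; bag = λ t v → v ∈ˢ bag t
  ; bag? = λ t v → v Subset.∈? bag t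
  ; top = λ v → proj₁ (highest v)
  ; top∈ = λ v → proj₁ (proj₂ (highest v))
  ; climb = climb
  }
  where
  open TreeDec D hiding (Node)
  highest : ∀ v → ∃[ t ] (v ∈ˢ bag t × ∀ s → v ∈ˢ bag s → toℕ t ≤ toℕ s)
  highest v = argmin (λ t → v Subset.∈? bag t) toℕ (vcover v)
  exit : ∀ {v i s t} → Star (λ a b → TAdj tree a b × v ∈ˢ bag a × v ∈ˢ bag b) s t →
         Desc tree (suc i) s → ¬ Desc tree (suc i) t → v ∈ˢ bag (par tree i)
  exit ε inside outside = contradiction inside outside
  exit ((up _ , _ , b∋v) ◅ _) self outside = b∋v
  exit ((up _ , _ , _) ◅ walk) (child inside) outside = exit walk inside outside
  exit ((down _ , _ , _) ◅ walk) inside outside = exit walk (child inside) outside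
  climb : ∀ {v t} → v ∈ˢ bag t → t ≢ proj₁ (highest v) → ∃[ i ] (t ≡ suc i × v ∈ˢ bag (par tree i))
  climb {v} {t} t∋v t≢ with highest v
  climb {v} {zero} t∋v t≢ | r , r∋v , least with r | least zero t∋v
  ... | zero | _ = contradiction refl t≢
  climb {v} {suc i} t∋v t≢ | r , r∋v , least =
    i , refl , exit (conn v (suc i) r t∋v r∋v) self
      (λ d → t≢ (Fin.toℕ-injective (ℕ.≤-antisym (Desc⇒≤ d) (least _ t∋v))))

module _ {n} (D : TopDec n) where
  open TopDec D

  Linked : (Fin n → Set) → Set
  Linked P = ∀ {u v} → P u → P v → Star (λ x y → P y × Touch x y) u v

  Meets : (Fin n → Set) → Node tree → Set
  Meets P t = ∃[ v ] (P v × bag t v)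

  IsTop : (Fin n → Set) → Node tree → Set
  IsTop P r = Meets P r × ∀ {t} → Meets P t → t ≢ r →
              ∃[ i ] (t ≡ suc i × ∃[ u ] (P u × bag (suc i) u × bag (par tree i) u))

  abstract
    -- The least index among the tops of vertices of `P` is chosen. A walk of touching vertices of
    -- `P` from the bag of `t` to the chosen vertex leaves the subtree of `t`; its first vertex with
    -- a top outside is in the bags of both `t` and its parent.
    classTop : ∀ {P} → Decidable P → ∃ P → Linked P → ∃ (IsTop P)
    classTop {P} P? nonempty linked with argmin P? (toℕ ∘ top) nonempty
    ... | w , Pw , least = top w , (w , Pw , top∈ w) , λ {t} (v , Pv , v∈) t≢ →
      cross (linked Pv Pw) Pv v∈ self
        (λ d → t≢ (Fin.toℕ-injective (ℕ.≤-antisym (Desc⇒≤ d) (ℕ.≤-trans (least v Pv) (top-≤ v∈)))))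
      where
      cross : ∀ {t s x} → Star (λ x y → P y × Touch x y) x w → P x → bag s x → Desc tree t s → ¬ Desc tree t (top w) →
              ∃[ i ] (t ≡ suc i × ∃[ u ] (P u × bag (suc i) u × bag (par tree i) u))
      cross {t} {s} {x} walk Px x∈ ts out with Desc? t (top x)
      ... | no out' with leave x∈ ts out'
      ...   | x∈t , i , refl , x∈p = i , refl , x , Px , x∈t , x∈p
      cross ε Px x∈ ts out | yes tx = contradiction tx out
      cross ((Py , r , x∈r , y∈r) ◅ walk) Px x∈ ts out | yes tx =
        cross walk Py y∈r (Desc-trans tx (bag⇒Desc x∈r)) out

  module _ {q} {P : Fin q → Fin n → Set} (P? : ∀ b → Decidable (P b)) where

    meets? : ∀ t → Decidable (λ b → Meets (P b) t)
    meets? t b = Fin.any? (λ v → P? b v ×-dec bag? t v)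

    -- The sets `P b` may overlap; linkedness makes the nodes meeting `P b` a subtree.
    contract : (∀ b → ∃ (P b)) → (∀ b → Linked (P b)) → TopDec q
    contract nonempty linked = record
      { tree = tree
      ; bag = λ t b → Meets (P b) t
      ; bag? = meets?
      ; top = λ b → proj₁ (ct b)
      ; top∈ = λ b → proj₁ (proj₂ (ct b))
      ; climb = λ {b} meets t≢ → let i , t≡ , u , Pu , _ , u∈ = proj₂ (proj₂ (ct b)) meets t≢ in i , t≡ , u , Pu , u∈
      }
      where
      ct : ∀ b → ∃ (IsTop (P b))
      ct b = classTop (P? b) (nonempty b) (linked b)

-- Every node t gets a leaf (t , w) for each vertex w, whose bag is the core of
-- t together with w whenever leaf t w holds. The subtree of suc i is reattached
-- at the leaf attach i of its parent, or at the parent itself.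
module StarExpansion {q} (T : RTree) {core leaf : Node T → Fin q → Set}
  (core? : ∀ t → Decidable (core t)) (leaf? : ∀ t → Decidable (leaf t))
  (attach : Fin (m T) → Maybe (Fin q)) (root : Fin q → Node T)
  (root∈ : ∀ b → core (root b) b ⊎ leaf (root b) b)
  (climbs : ∀ {b t} → core t b ⊎ leaf t b → t ≢ root b → core t b ×
            ∃[ i ] (t ≡ suc i × (core (par T i) b ⊎ attach i ≡ just b × leaf (par T i) b)))
  where

  private
    -- Of the `suc q` copies of a node, `zero` is the centre and `suc w` the leaf of `w`.
    position : Maybe (Fin q) → Fin (suc q)
    position nothing = zero
    position (just w) = suc w

    node : Node T × Fin (suc q) → Fin (suc (m T) * suc q)
    node (t , w) = combine t w

    parent : Node T × Fin (suc q) → Fin (suc (m T) * suc q)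
    parent (t , suc w) = node (t , zero)
    parent (zero , zero) = zero
    parent (suc i , zero) = node (par T i , position (attach i))

    split : Fin (suc (m T) * suc q) → Node T × Fin (suc q)
    split = remQuot (suc q)

    -- `combine` orders pairs lexicographically: a leaf comes after its centre, and each copy of a
    -- node after all copies of its parent.
    parent-< : ∀ tw → node tw ≢ zero → parent tw Fin.< node tw
    parent-< (t , suc w) _ = subst₂ _<_ (sym (Fin.toℕ-combine t zero)) (sym (Fin.toℕ-combine t (suc w)))
                             (ℕ.+-monoʳ-< (suc q * toℕ t) (s≤s z≤n))
    parent-< (zero , zero) ≢zero = contradiction refl ≢zero
    parent-< (suc i , zero) _ = Fin.combine-monoˡ-< (position (attach i)) zero (s≤s (par-lt T i))

    expanded : RTree
    expanded = record
      { m = q + m T * suc q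
      ; par = λ i → parent (split (suc i))
      ; par-lt = λ i → ℕ.≤-pred (subst (λ x → toℕ (parent (split (suc i))) < toℕ x)
          (Fin.combine-remQuot {suc (m T)} (suc q) (suc i))
          (parent-< (split (suc i)) (λ eq → case trans (sym (Fin.combine-remQuot {suc (m T)} (suc q) (suc i))) eq of λ ())))
      }

    Bag : Node T × Fin (suc q) → Fin q → Set
    Bag (t , zero) b = core t b
    Bag (t , suc w) b = core t b ⊎ b ≡ w × leaf t b

    Bag? : ∀ tw → Decidable (Bag tw)
    Bag? (t , zero) b = core? t b
    Bag? (t , suc w) b = core? t b ⊎-dec (b Fin.≟ w ×-dec leaf? t b)

    at-node : ∀ tw {b} → Bag tw b → Bag (split (node tw)) b
    at-node (t , w) {b} = subst (λ x → Bag x b) (sym (Fin.remQuot-combine t w))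

    place : ∀ b → Dec (core (root b) b) → Node T × Fin (suc q)
    place b (yes _) = root b , zero
    place b (no _) = root b , suc b

    place∈ : ∀ b d → Bag (place b d) b
    place∈ b (yes b∈) = b∈
    place∈ b (no b∉) with root∈ b
    ... | inj₁ b∈ = contradiction b∈ b∉
    ... | inj₂ b∈ = inj₂ (refl , b∈)

    toParent : ∀ {b} tw → Bag tw b → ∀ d → tw ≢ place b d → Bag (split (parent tw)) b × node tw ≢ zero
    toParent {b} (t , suc w) b∈ d ≢place = at-node (t , zero) (inCore b∈ d ≢place) , λ eq →
      case Fin.combine-injectiveʳ t (suc w) zero zero eq of λ ()
      where
      inCore : Bag (t , suc w) b → ∀ d → (t , suc w) ≢ place b d → core t b
      inCore (inj₁ b∈) _ _ = b∈
      inCore (inj₂ (refl , b∈)) d ≢place with t Fin.≟ root b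
      ... | no t≢ = proj₁ (climbs (inj₂ b∈) t≢)
      inCore (inj₂ (refl , b∈)) (yes c) ≢place | yes refl = c
      inCore (inj₂ (refl , b∈)) (no _) ≢place | yes refl = contradiction refl ≢place
    toParent {b} (t , zero) b∈ d ≢place with climbs (inj₁ b∈) (t≢ d ≢place)
      where
      t≢ : ∀ d → (t , zero) ≢ place b d → t ≢ root b
      t≢ (yes _) ≢place refl = ≢place refl
      t≢ (no b∉) ≢place refl = b∉ b∈
    ... | _ , i , refl , upper = at-node (par T i , position (attach i)) (reattached (attach i) upper) , λ eq → case Fin.combine-injectiveˡ (suc i) zero zero zero eq of λ ()
      where
      reattached : ∀ a → core (par T i) b ⊎ a ≡ just b × leaf (par T i) b → Bag (par T i , position a) b
      reattached nothing (inj₁ b∈) = b∈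
      reattached (just w) (inj₁ b∈) = inj₁ b∈
      reattached _ (inj₂ (refl , b∈)) = inj₂ (refl , b∈)

  expansion : TopDec q
  expansion = record
    { tree = expanded
    ; bag = λ x → Bag (split x)
    ; bag? = λ x → Bag? (split x)
    ; top = λ b → node (place b (core? (root b) b))
    ; top∈ = λ b → at-node (place b (core? (root b) b)) (place∈ b (core? (root b) b))
    ; climb = climb
    }
    where
    climb : ∀ {b x} → Bag (split x) b → x ≢ node (place b (core? (root b) b)) →
            ∃[ i ] (x ≡ suc i × Bag (split (par expanded i)) b)
    climb {b} {x} b∈ x≢ with toParent (split x) b∈ (core? (root b) b)
        (λ eq → x≢ (trans (sym (Fin.combine-remQuot {suc (m T)} (suc q) x)) (cong node eq)))
    ... | b∈' , ≢zero with x
    ...   | zero = contradiction (Fin.combine-remQuot {suc (m T)} (suc q) zero) ≢zero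
    ...   | suc i = i , refl , b∈'

  expansion-touch : ∀ {a b} t → core t a → core t b ⊎ leaf t b → TopDec.Touch expansion a b
  expansion-touch {a} {b} t a∈ b∈ = node (t , suc b) , at-node (t , suc b) (inj₁ a∈) , at-node (t , suc b) (within b∈)
    where
    within : core t b ⊎ leaf t b → Bag (t , suc b) b
    within (inj₁ b∈) = inj₁ b∈
    within (inj₂ b∈) = inj₂ (refl , b∈)

  expansion-small : ∀ {c} → (∀ t → AtMost c (core t)) → ∀ x → AtMost (suc c) (TopDec.bag expansion x)
  expansion-small {c} small x = atMost-mono (ℕ.≤-reflexive (ℕ.+-comm c 1)) id (few (split x))
    where
    few : ∀ tw → AtMost (c + 1) (Bag tw)
    few (t , zero) = atMost-mono (ℕ.m≤m+n c 1) id (small t)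
    few (t , suc w) = atMost-mono ℕ.≤-refl (λ { (inj₁ b∈) → inj₁ b∈ ; (inj₂ (b≡w , _)) → inj₂ b≡w })
                        (atMost-∪ (small t) (atMost-point w))

-- Packing and covering of A-paths

Avoid : ∀ {n} → Rel n → (Fin n → Set) → Rel n
Avoid E X u v = E u v × ¬ X u × ¬ X v

halve-≤ : ∀ {k l} → k + k ≤ l + l → k ≤ l
halve-≤ {k} {l} 2k≤2l = ℕ.≮⇒≥ λ l<k → ℕ.<⇒≱ (ℕ.+-mono-< l<k l<k) 2k≤2l

interchange : ∀ a b c d → (a + b) + (c + d) ≡ (a + c) + (b + d)
interchange = solve-∀

module APaths {n} {E : Rel n} (E? : ∀ u v → Dec (E u v)) (E-sym : ∀ {u v} → E u v → E v u)
              {A : Fin n → Set} (A? : Decidable A) where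

  open DecMembership (Fin._≟_ {n}) using (_∈?_)

  Within : (Fin n → Set) → Rel n
  Within L u v = E u v × L u × L v

  widen : ∀ {L M : Fin n → Set} → (∀ {v} → L v → M v) → ∀ {u v} → Star (Within L) u v → Star (Within M) u v
  widen L⇒M = Star.map (λ (e , u∈ , v∈) → e , L⇒M u∈ , L⇒M v∈)

  -- An A-path is kept as a walk in a region. Disjointness is required of the regions, and the walk
  -- is made simple only when flowers are formed.
  record Blob : Set₁ where
    constructor blob
    field
      {region} : Fin n → Set
      {source target} : Fin n
      source∈A : A source
      target∈A : A target
      distinct : source ≢ target
      walk     : Star (Within region) source target
  open Blob using (region)

  Apart : Blob → Blob → Set
  Apart B C = ∀ v → region B v → ¬ region C v

  record Packing (P : Fin n → Set) : Set₁ where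
    constructor packing
    field
      blobs  : List Blob
      inside : All (λ B → ∀ v → region B v → P v) blobs
      apart  : AllPairs Apart blobs

    size : ℕ
    size = length blobs
  open Packing

  relax : ∀ {P Q : Fin n → Set} → (∀ {v} → P v → Q v) → Packing P → Packing Q
  relax P⇒Q (packing bs ins ap) = packing bs (All.map (λ ⊆P v r → P⇒Q (⊆P v r)) ins) ap

  join : ∀ {P Q : Fin n → Set} → (∀ {v} → P v → ¬ Q v) → Packing P → Packing Q → Packing (λ v → P v ⊎ Q v)
  join disj (packing bs ins ap) (packing cs jns aq) = packing (bs List.++ cs)
    (All.++⁺ (All.map (λ ⊆P v r → inj₁ (⊆P v r)) ins) (All.map (λ ⊆Q v r → inj₂ (⊆Q v r)) jns))
    (AllPairs.++⁺ ap aq (All.map (λ ⊆P → All.map (λ ⊆Q v r r' → disj (⊆P v r) (⊆Q v r')) jns) ins))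

  size-join : ∀ {P Q} (disj : ∀ {v} → P v → ¬ Q v) (p : Packing P) (q : Packing Q) →
              size (join {P} {Q} disj p q) ≡ size p + size q
  size-join disj p q = List.length-++ (blobs p)

  -- A subcubic tree hanging from r whose leaves are its only vertices of A,
  -- except possibly for some of its branching vertices.
  data Tree : Fin n → Set
  _∈ᵗ_ : ∀ {r} → Fin n → Tree r → Set

  data Tree where
    leaf : ∀ {a} → A a → Tree a
    step : ∀ {r s} → ¬ A r → E r s → (t : Tree s) → ¬ (r ∈ᵗ t) → Tree r
    fork : ∀ {r s s'} → E r s → E r s' → (t : Tree s) (t' : Tree s') →
           ¬ (r ∈ᵗ t) → ¬ (r ∈ᵗ t') → (∀ {v} → v ∈ᵗ t → ¬ (v ∈ᵗ t')) → Tree r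

  v ∈ᵗ leaf {a} _ = v ≡ a
  v ∈ᵗ step {r} _ _ t _ = v ≡ r ⊎ v ∈ᵗ t
  v ∈ᵗ fork {r} _ _ t t' _ _ _ = v ≡ r ⊎ v ∈ᵗ t ⊎ v ∈ᵗ t'

  root∈ᵗ : ∀ {r} (t : Tree r) → r ∈ᵗ t
  root∈ᵗ (leaf _) = refl
  root∈ᵗ (step _ _ _ _) = inj₁ refl
  root∈ᵗ (fork _ _ _ _ _ _ _) = inj₁ refl

  _∈ᵗ?_ : ∀ {r} v (t : Tree r) → Dec (v ∈ᵗ t)
  v ∈ᵗ? leaf {a} _ = v Fin.≟ a
  v ∈ᵗ? step {r} _ _ t _ = v Fin.≟ r ⊎-dec v ∈ᵗ? t
  v ∈ᵗ? fork {r} _ _ t t' _ _ _ = v Fin.≟ r ⊎-dec v ∈ᵗ? t ⊎-dec v ∈ᵗ? t'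

  leaves : ∀ {r} → Tree r → ℕ
  leaves (leaf _) = 1
  leaves (step _ _ t _) = leaves t
  leaves (fork _ _ t t' _ _ _) = leaves t + leaves t'

  leaves>0 : ∀ {r} (t : Tree r) → 1 ≤ leaves t
  leaves>0 (leaf _) = ℕ.≤-refl
  leaves>0 (step _ _ t _) = leaves>0 t
  leaves>0 (fork _ _ t t' _ _ _) = ℕ.≤-trans (leaves>0 t) (ℕ.m≤m+n _ _)

  -- Leaves and branching vertices. Every other vertex is a `step`, outside A, at which a further
  -- branch can be inserted.
  special : ∀ {r} → Tree r → List (Fin n)
  special (leaf {a} _) = a ∷ []
  special (step _ _ t _) = special t
  special (fork {r} _ _ t t' _ _ _) = r ∷ special t List.++ special t'

  -- A tree with `l` leaves has `l - 1` branching vertices.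
  ∣special∣ : ∀ {r} (t : Tree r) → suc (length (special t)) ≤ leaves t + leaves t
  ∣special∣ (leaf _) = ℕ.≤-refl
  ∣special∣ (step _ _ t _) = ∣special∣ t
  ∣special∣ (fork _ _ t t' _ _ _) = begin
    suc (suc (length (special t List.++ special t')))       ≡⟨ cong (2 +_) (List.length-++ (special t)) ⟩
    suc (suc (length (special t) + length (special t')))    ≡⟨ cong suc (ℕ.+-suc _ _) ⟨
    suc (length (special t)) + suc (length (special t'))    ≤⟨ ℕ.+-mono-≤ (∣special∣ t) (∣special∣ t') ⟩
    (leaves t + leaves t) + (leaves t' + leaves t')         ≡⟨ interchange (leaves t) _ _ _ ⟩
    (leaves t + leaves t') + (leaves t + leaves t')         ∎
    where open ℕ.≤-Reasoning

  A⇒special : ∀ {r v} (t : Tree r) → A v → v ∈ᵗ t → v ∈ special t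
  A⇒special (leaf _) Av refl = here refl
  A⇒special (step ¬Ar _ t _) Av (inj₁ refl) = contradiction Av ¬Ar
  A⇒special (step _ _ t _) Av (inj₂ v∈) = A⇒special t Av v∈
  A⇒special (fork _ _ t t' _ _ _) Av (inj₁ refl) = here refl
  A⇒special (fork _ _ t t' _ _ _) Av (inj₂ (inj₁ v∈)) = there (∈.∈-++⁺ˡ (A⇒special t Av v∈))
  A⇒special (fork _ _ t t' _ _ _) Av (inj₂ (inj₂ v∈)) = there (∈.∈-++⁺ʳ (special t) (A⇒special t' Av v∈))

  -- Cuts loops in `grow`: when the walk returns to `y`, the part hanging from `y` is kept.
  subtree : ∀ {r y} (t : Tree r) → y ∈ᵗ t → Σ (Tree y) λ t' → ∀ {v} → v ∈ᵗ t' → v ∈ᵗ t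
  subtree (leaf a) refl = leaf a , id
  subtree t@(step _ _ _ _) (inj₁ refl) = t , id
  subtree (step _ _ t _) (inj₂ y∈) with subtree t y∈
  ... | t' , ⊆t = t' , inj₂ ∘ ⊆t
  subtree t@(fork _ _ _ _ _ _ _) (inj₁ refl) = t , id
  subtree (fork _ _ t _ _ _ _) (inj₂ (inj₁ y∈)) with subtree t y∈
  ... | t' , ⊆t = t' , inj₂ ∘ inj₁ ∘ ⊆t
  subtree (fork _ _ _ t _ _ _) (inj₂ (inj₂ y∈)) with subtree t y∈
  ... | t' , ⊆t = t' , inj₂ ∘ inj₂ ∘ ⊆t

  module _ {u w} (e : E u w) (N : Tree w) where

    -- The non-special vertex `u` is a `step`; it becomes a `fork` with the new branch `N`.
    insert : ∀ {r} (t : Tree r) → u ∈ᵗ t → ¬ (u ∈ special t) → (∀ {v} → v ∈ᵗ t → ¬ (v ∈ᵗ N)) →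
             Σ (Tree r) λ t' → (∀ {v} → v ∈ᵗ t' → v ∈ᵗ t ⊎ v ∈ᵗ N) × leaves t' ≡ leaves t + leaves N
    insert (leaf _) refl plain _ = contradiction (here refl) plain
    insert (step _ e' t u∉t) (inj₁ refl) _ disj =
      fork e' e t N u∉t (disj (inj₁ refl)) (disj ∘ inj₂) ,
      (λ { (inj₁ v≡) → inj₁ (inj₁ v≡) ; (inj₂ (inj₁ v∈)) → inj₁ (inj₂ v∈) ; (inj₂ (inj₂ v∈)) → inj₂ v∈ }) , refl
    insert (step ¬A e' t r∉t) (inj₂ u∈) plain disj with insert t u∈ plain (disj ∘ inj₂)
    ... | t' , ⊆ , same =
      step ¬A e' t' ([ r∉t , disj (inj₁ refl) ]′ ∘ ⊆) ,
      (λ { (inj₁ v≡) → inj₁ (inj₁ v≡) ; (inj₂ v∈) → [ inj₁ ∘ inj₂ , inj₂ ]′ (⊆ v∈) }) , same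
    insert (fork _ _ _ _ _ _ _) (inj₁ refl) plain _ = contradiction (here refl) plain
    insert (fork e₁ e₂ t₁ t₂ r∉₁ r∉₂ d) (inj₂ (inj₁ u∈)) plain disj
      with insert t₁ u∈ (plain ∘ there ∘ ∈.∈-++⁺ˡ) (disj ∘ inj₂ ∘ inj₁)
    ... | t' , ⊆ , same =
      fork e₁ e₂ t' t₂ ([ r∉₁ , disj (inj₁ refl) ]′ ∘ ⊆) r∉₂
        (λ v∈ v∈₂ → [ (λ v∈₁ → d v∈₁ v∈₂) , disj (inj₂ (inj₂ v∈₂)) ]′ (⊆ v∈)) ,
      (λ { (inj₁ v≡) → inj₁ (inj₁ v≡) ; (inj₂ (inj₁ v∈)) → [ inj₁ ∘ inj₂ ∘ inj₁ , inj₂ ]′ (⊆ v∈)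
         ; (inj₂ (inj₂ v∈)) → inj₁ (inj₂ (inj₂ v∈)) }) ,
      trans (cong (_+ leaves t₂) same) (swapʳ (leaves t₁) (leaves N) (leaves t₂))
      where
      swapʳ : ∀ a b c → (a + b) + c ≡ (a + c) + b
      swapʳ = solve-∀
    insert (fork e₁ e₂ t₁ t₂ r∉₁ r∉₂ d) (inj₂ (inj₂ u∈)) plain disj
      with insert t₂ u∈ (plain ∘ there ∘ ∈.∈-++⁺ʳ (special t₁)) (disj ∘ inj₂ ∘ inj₂)
    ... | t' , ⊆ , same =
      fork e₁ e₂ t₁ t' r∉₁ ([ r∉₂ , disj (inj₁ refl) ]′ ∘ ⊆)
        (λ v∈₁ v∈ → [ d v∈₁ , disj (inj₂ (inj₁ v∈₁)) ]′ (⊆ v∈)) ,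
      (λ { (inj₁ v≡) → inj₁ (inj₁ v≡) ; (inj₂ (inj₁ v∈)) → inj₁ (inj₂ (inj₁ v∈))
         ; (inj₂ (inj₂ v∈)) → [ inj₁ ∘ inj₂ ∘ inj₂ , inj₂ ]′ (⊆ v∈) }) ,
      trans (cong (leaves t₁ +_) same) (sym (ℕ.+-assoc (leaves t₁) _ _))

  record Pending (r : Fin n) (P : Fin n → Set) (bs : List Blob) : Set₁ where
    field
      {region} : Fin n → Set
      {target} : Fin n
      target∈A : A target
      walk     : Star (Within region) r target
      source∈  : region r
      target∈  : region target
      inside   : ∀ {v} → region v → P v
      apart    : All (λ B → ∀ v → region v → ¬ Blob.region B v) bs

  -- Pairing up the leaves bottom-up: at most one leaf at a time is left over,
  -- and it stays connected to the root.
  extract : ∀ {r} (t : Tree r) → Σ (Packing (_∈ᵗ t)) λ p →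
            leaves t ≤ size p + size p ⊎ Pending r (_∈ᵗ t) (blobs p) × leaves t ≤ suc (size p + size p)
  extract (leaf {a} Aa) = packing [] [] [] , inj₂ (record
    { region = _≡ a ; target∈A = Aa ; walk = ε ; source∈ = refl ; target∈ = refl ; inside = id ; apart = [] } , ℕ.≤-refl)
  extract (step {r} _ e t r∉) with extract t
  ... | p , inj₁ enough = relax inj₂ p , inj₁ enough
  ... | p , inj₂ (pend , enough) = relax inj₂ p , inj₂ (record
    { region = λ v → v ≡ r ⊎ P.region v
    ; target∈A = P.target∈A
    ; walk = (e , inj₁ refl , inj₂ P.source∈) ◅ widen inj₂ P.walk
    ; source∈ = inj₁ refl ; target∈ = inj₂ P.target∈
    ; inside = λ { (inj₁ v≡) → inj₁ v≡ ; (inj₂ v∈) → inj₂ (P.inside v∈) }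
    ; apart = All.zipWith (λ (⊆t , ap) → λ { _ (inj₁ refl) r∈ → r∉ (⊆t _ r∈) ; v (inj₂ v∈) → ap v v∈ }) (inside p , P.apart)
    } , enough)
    where module P = Pending pend
  extract (fork {r} e₁ e₂ t₁ t₂ r∉₁ r∉₂ d) with extract t₁ | extract t₂
  ... | p₁ , p₁⊇ | p₂ , p₂⊇ = merge p₁⊇ p₂⊇
    where
    open ℕ.≤-Reasoning
    p : Packing (λ v → v ≡ r ⊎ v ∈ᵗ t₁ ⊎ v ∈ᵗ t₂)
    p = relax inj₂ (join d p₁ p₂)
    size-p : ∀ c → c + ((size p₁ + size p₁) + (size p₂ + size p₂)) ≡ c + (size p + size p)
    size-p c = cong (c +_) (trans (interchange (size p₁) _ _ _) (cong₂ _+_ (sym (size-join d p₁ p₂)) (sym (size-join d p₁ p₂))))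
    through : ∀ {s P bs} → E r s → (q : Pending s P bs) →
              Star (Within (λ v → v ≡ r ⊎ Pending.region q v)) r (Pending.target q)
    through e q = (e , inj₁ refl , inj₂ (Pending.source∈ q)) ◅ widen inj₂ (Pending.walk q)
    Goal : Set₁
    Goal = Σ (Packing (λ v → v ≡ r ⊎ v ∈ᵗ t₁ ⊎ v ∈ᵗ t₂)) λ p → leaves t₁ + leaves t₂ ≤ size p + size p ⊎
      Pending r (λ v → v ≡ r ⊎ v ∈ᵗ t₁ ⊎ v ∈ᵗ t₂) (blobs p) × leaves t₁ + leaves t₂ ≤ suc (size p + size p)
    merge : leaves t₁ ≤ size p₁ + size p₁ ⊎ Pending _ (_∈ᵗ t₁) (blobs p₁) × leaves t₁ ≤ suc (size p₁ + size p₁) →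
            leaves t₂ ≤ size p₂ + size p₂ ⊎ Pending _ (_∈ᵗ t₂) (blobs p₂) × leaves t₂ ≤ suc (size p₂ + size p₂) → Goal
    merge (inj₁ ≤₁) (inj₁ ≤₂) = p , inj₁ (ℕ.≤-trans (ℕ.+-mono-≤ ≤₁ ≤₂) (ℕ.≤-reflexive (size-p 0)))
    merge (inj₂ (q , ≤₁)) (inj₁ ≤₂) = p , inj₂ (record
      { region = λ v → v ≡ r ⊎ Q.region v
      ; target∈A = Q.target∈A ; walk = through e₁ q ; source∈ = inj₁ refl ; target∈ = inj₂ Q.target∈
      ; inside = λ { (inj₁ v≡) → inj₁ v≡ ; (inj₂ v∈) → inj₂ (inj₁ (Q.inside v∈)) }
      ; apart = All.++⁺
          (All.zipWith (λ (⊆t , ap) → λ { _ (inj₁ refl) r∈ → r∉₁ (⊆t _ r∈) ; v (inj₂ v∈) → ap v v∈ }) (inside p₁ , Q.apart))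
          (All.map (λ ⊆t → λ { _ (inj₁ refl) r∈ → r∉₂ (⊆t _ r∈) ; _ (inj₂ v∈) v∈' → d (Q.inside v∈) (⊆t _ v∈') }) (inside p₂))
      } , ℕ.≤-trans (ℕ.+-mono-≤ ≤₁ ≤₂) (ℕ.≤-reflexive (size-p 1)))
      where module Q = Pending q
    merge (inj₁ ≤₁) (inj₂ (q , ≤₂)) = p , inj₂ (record
      { region = λ v → v ≡ r ⊎ Q.region v
      ; target∈A = Q.target∈A ; walk = through e₂ q ; source∈ = inj₁ refl ; target∈ = inj₂ Q.target∈
      ; inside = λ { (inj₁ v≡) → inj₁ v≡ ; (inj₂ v∈) → inj₂ (inj₂ (Q.inside v∈)) }
      ; apart = All.++⁺
          (All.map (λ ⊆t → λ { _ (inj₁ refl) r∈ → r∉₁ (⊆t _ r∈) ; _ (inj₂ v∈) v∈' → d (⊆t _ v∈') (Q.inside v∈) }) (inside p₁))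
          (All.zipWith (λ (⊆t , ap) → λ { _ (inj₁ refl) r∈ → r∉₂ (⊆t _ r∈) ; v (inj₂ v∈) → ap v v∈ }) (inside p₂ , Q.apart))
      } , ℕ.≤-trans (ℕ.+-mono-≤ ≤₁ ≤₂) (ℕ.≤-reflexive (trans (ℕ.+-suc _ _) (size-p 1))))
      where module Q = Pending q
    -- Both sides have a leaf left over; their connections to `r` combine into one more A-path.
    merge (inj₂ (q , ≤₁)) (inj₂ (q' , ≤₂)) = packing (b ∷ blobs p)
      ((λ { _ (inj₁ v≡) → inj₁ v≡ ; _ (inj₂ (inj₁ v∈)) → inj₂ (inj₁ (Q.inside v∈)) ; _ (inj₂ (inj₂ v∈)) → inj₂ (inj₂ (Q'.inside v∈)) })
        ∷ inside p)
      (All.++⁺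
        (All.zipWith (λ (⊆t , ap) → λ { _ (inj₁ refl) r∈ → r∉₁ (⊆t _ r∈) ; v (inj₂ (inj₁ v∈)) → ap v v∈
                                     ; _ (inj₂ (inj₂ v∈)) v∈' → d (⊆t _ v∈') (Q'.inside v∈) }) (inside p₁ , Q.apart))
        (All.zipWith (λ (⊆t , ap) → λ { _ (inj₁ refl) r∈ → r∉₂ (⊆t _ r∈) ; _ (inj₂ (inj₁ v∈)) v∈' → d (Q.inside v∈) (⊆t _ v∈')
                                     ; v (inj₂ (inj₂ v∈)) → ap v v∈ }) (inside p₂ , Q'.apart))
       ∷ apart p) ,
      inj₁ (begin
        leaves t₁ + leaves t₂                                         ≤⟨ ℕ.+-mono-≤ ≤₁ ≤₂ ⟩
        suc (size p₁ + size p₁) + suc (size p₂ + size p₂)             ≡⟨ ℕ.+-suc (suc (size p₁ + size p₁)) _ ⟩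
        2 + ((size p₁ + size p₁) + (size p₂ + size p₂))               ≡⟨ size-p 2 ⟩
        2 + (size p + size p)                                         ≡⟨ cong suc (ℕ.+-suc (size p) (size p)) ⟨
        suc (size p) + suc (size p)                                   ∎)
      where
      module Q = Pending q
      module Q' = Pending q'
      b : Blob
      b = blob {region = λ v → v ≡ r ⊎ Q.region v ⊎ Q'.region v} Q.target∈A Q'.target∈A
            (λ eq → d (Q.inside Q.target∈) (subst (_∈ᵗ t₂) (sym eq) (Q'.inside Q'.target∈)))
            (Star.reverse (λ (e , u∈ , v∈) → E-sym e , v∈ , u∈)
               (widen (λ { (inj₁ v≡) → inj₁ v≡ ; (inj₂ v∈) → inj₂ (inj₁ v∈) }) (through e₁ q))
             ◅◅ widen (λ { (inj₁ v≡) → inj₁ v≡ ; (inj₂ v∈) → inj₂ (inj₂ v∈) }) (through e₂ q'))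

  -- A component is a tree with an additional root `r` in A, so that even a single leaf yields an
  -- A-path. These roots are not counted as leaves.
  data Forest : Set
  _∈ᶠ_ : Fin n → Forest → Set

  data Forest where
    []  : Forest
    add : ∀ {r s} → A r → E r s → (t : Tree s) → ¬ (r ∈ᵗ t) → (F : Forest) → ¬ (r ∈ᶠ F) →
          (∀ {v} → v ∈ᵗ t → ¬ (v ∈ᶠ F)) → Forest

  v ∈ᶠ [] = ⊥
  v ∈ᶠ add {r} _ _ t _ F _ _ = v ≡ r ⊎ v ∈ᵗ t ⊎ v ∈ᶠ F

  _∈ᶠ?_ : ∀ v F → Dec (v ∈ᶠ F)
  v ∈ᶠ? [] = no λ ()
  v ∈ᶠ? add {r} _ _ t _ F _ _ = v Fin.≟ r ⊎-dec v ∈ᵗ? t ⊎-dec v ∈ᶠ? F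

  leavesᶠ : Forest → ℕ
  leavesᶠ [] = 0
  leavesᶠ (add _ _ t _ F _ _) = leaves t + leavesᶠ F

  specialᶠ : Forest → List (Fin n)
  specialᶠ [] = []
  specialᶠ (add {r} _ _ t _ F _ _) = (r ∷ special t) List.++ specialᶠ F

  -- The root of a component takes up the slack of one in `∣special∣`.
  ∣specialᶠ∣ : ∀ F → length (specialᶠ F) ≤ leavesᶠ F + leavesᶠ F
  ∣specialᶠ∣ [] = z≤n
  ∣specialᶠ∣ (add {r} _ _ t _ F _ _) = begin
    length ((r ∷ special t) List.++ specialᶠ F)          ≡⟨ List.length-++ (r ∷ special t) ⟩
    suc (length (special t)) + length (specialᶠ F)       ≤⟨ ℕ.+-mono-≤ (∣special∣ t) (∣specialᶠ∣ F) ⟩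
    (leaves t + leaves t) + (leavesᶠ F + leavesᶠ F)      ≡⟨ interchange (leaves t) _ _ _ ⟩
    (leaves t + leavesᶠ F) + (leaves t + leavesᶠ F)      ∎
    where open ℕ.≤-Reasoning

  A⇒specialᶠ : ∀ {v} F → A v → v ∈ᶠ F → v ∈ specialᶠ F
  A⇒specialᶠ (add _ _ t _ F _ _) Av (inj₁ refl) = here refl
  A⇒specialᶠ (add _ _ t _ F _ _) Av (inj₂ (inj₁ v∈)) = there (∈.∈-++⁺ˡ (A⇒special t Av v∈))
  A⇒specialᶠ (add _ _ t _ F _ _) Av (inj₂ (inj₂ v∈)) = there (∈.∈-++⁺ʳ (special t) (A⇒specialᶠ F Av v∈))

  insertᶠ : ∀ {u w} → E u w → (N : Tree w) → ∀ F → u ∈ᶠ F → ¬ (u ∈ specialᶠ F) → (∀ {v} → v ∈ᵗ N → ¬ (v ∈ᶠ F)) →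
            Σ Forest λ F' → (∀ {v} → v ∈ᶠ F' → v ∈ᶠ F ⊎ v ∈ᵗ N) × leavesᶠ F' ≡ leaves N + leavesᶠ F
  insertᶠ e N (add _ _ _ _ _ _ _) (inj₁ refl) plain _ = contradiction (here refl) plain
  insertᶠ e N (add Ar e' t r∉t F r∉F d) (inj₂ (inj₁ u∈)) plain disj
    with insert e N t u∈ (plain ∘ there ∘ ∈.∈-++⁺ˡ) (λ v∈t v∈N → disj v∈N (inj₂ (inj₁ v∈t)))
  ... | t' , ⊆ , same =
    add Ar e' t' ([ r∉t , (λ r∈N → disj r∈N (inj₁ refl)) ]′ ∘ ⊆) F r∉F
      (λ v∈ v∈F → [ (λ v∈t → d v∈t v∈F) , (λ v∈N → disj v∈N (inj₂ (inj₂ v∈F))) ]′ (⊆ v∈)) ,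
    (λ { (inj₁ v≡) → inj₁ (inj₁ v≡) ; (inj₂ (inj₁ v∈)) → [ inj₁ ∘ inj₂ ∘ inj₁ , inj₂ ]′ (⊆ v∈)
       ; (inj₂ (inj₂ v∈)) → inj₁ (inj₂ (inj₂ v∈)) }) ,
    trans (cong (_+ leavesᶠ F) same) (swapˡ (leaves t) (leaves N) (leavesᶠ F))
    where
    swapˡ : ∀ a b c → (a + b) + c ≡ b + (a + c)
    swapˡ = solve-∀
  insertᶠ e N (add Ar e' t r∉t F r∉F d) (inj₂ (inj₂ u∈)) plain disj
    with insertᶠ e N F u∈ (plain ∘ there ∘ ∈.∈-++⁺ʳ (special t)) (λ v∈N v∈F → disj v∈N (inj₂ (inj₂ v∈F)))
  ... | F' , ⊆ , same =
    add Ar e' t r∉t F' ([ r∉F , (λ r∈N → disj r∈N (inj₁ refl)) ]′ ∘ ⊆)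
      (λ v∈t v∈ → [ d v∈t , (λ v∈N → disj v∈N (inj₂ (inj₁ v∈t))) ]′ (⊆ v∈)) ,
    (λ { (inj₁ v≡) → inj₁ (inj₁ v≡) ; (inj₂ (inj₁ v∈)) → inj₁ (inj₂ (inj₁ v∈))
       ; (inj₂ (inj₂ v∈)) → [ inj₁ ∘ inj₂ ∘ inj₂ , inj₂ ]′ (⊆ v∈) }) ,
    trans (cong (leaves t +_) same) (swap (leaves t) (leaves N) (leavesᶠ F))
    where
    swap : ∀ a b c → a + (b + c) ≡ b + (a + c)
    swap = solve-∀

  -- A leaf left over by `extract` is paired with the root of its component.
  extractᶠ : ∀ F → Σ (Packing (_∈ᶠ F)) λ p → leavesᶠ F ≤ size p + size p
  extractᶠ [] = packing [] [] [] , z≤n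
  extractᶠ (add {r} Ar e t r∉t F r∉F d) with component | extractᶠ F
    where
    component : Σ (Packing (λ v → v ≡ r ⊎ v ∈ᵗ t)) λ p → leaves t ≤ size p + size p
    component with extract t
    ... | p , inj₁ enough = relax inj₂ p , enough
    ... | p , inj₂ (q , enough) =
      packing
        (blob {region = λ v → v ≡ r ⊎ Q.region v} Ar Q.target∈A (λ { refl → r∉t (Q.inside Q.target∈) })
          ((e , inj₁ refl , inj₂ Q.source∈) ◅ widen inj₂ Q.walk) ∷ blobs p)
        ((λ { _ (inj₁ v≡) → inj₁ v≡ ; _ (inj₂ v∈) → inj₂ (Q.inside v∈) }) ∷ inside (relax {Q = λ v → v ≡ r ⊎ v ∈ᵗ t} inj₂ p))
        (All.zipWith (λ (⊆t , ap) → λ { _ (inj₁ refl) r∈ → r∉t (⊆t _ r∈) ; v (inj₂ v∈) → ap v v∈ }) (inside p , Q.apart) ∷ apart p) ,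
      ℕ.≤-trans enough (s≤s (ℕ.+-monoʳ-≤ (size p) (ℕ.n≤1+n _)))
      where module Q = Pending q
  ... | p , ≤p | q , ≤q =
    relax (λ { (inj₁ (inj₁ v≡)) → inj₁ v≡ ; (inj₁ (inj₂ v∈)) → inj₂ (inj₁ v∈) ; (inj₂ v∈) → inj₂ (inj₂ v∈) }) (join disj p q) ,
    ℕ.≤-trans (ℕ.+-mono-≤ ≤p ≤q) (ℕ.≤-reflexive (trans (interchange (size p) _ _ _)
      (cong₂ _+_ (sym (size-join disj p q)) (sym (size-join disj p q)))))
    where
    disj : ∀ {v} → v ≡ r ⊎ v ∈ᵗ t → ¬ (v ∈ᶠ F)
    disj (inj₁ refl) = r∉F
    disj (inj₂ v∈) = d v∈

  -- An A-path avoiding the special vertices starts outside F, so its initial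
  -- segment either reaches F at a vertex of degree 2 or is a new component.
  grow : ∀ F {a a'} → A a → A a' → a ≢ a' → ¬ (a ∈ specialᶠ F) → Star (Avoid E (_∈ specialᶠ F)) a a' →
         ∃[ F' ] leavesᶠ F < leavesᶠ F'
  grow F {a} {a'} Aa Aa' a≢a' a∉ walk =
    follow walk (leaf Aa) (λ v≡a _ → v≡a) (λ { refl a∈F → a∉ (A⇒specialᶠ F Aa a∈F) })
    where
    -- `t` is the segment walked so far without its loops, rooted at the current vertex `x` and
    -- ending in the leaf `a`. On reaching `F` it is inserted there; on reaching a new vertex of A
    -- it becomes a component rooted at that vertex.
    follow : ∀ {x} → Star (Avoid E (_∈ specialᶠ F)) x a' → (t : Tree x) → (∀ {v} → v ∈ᵗ t → A v → v ≡ a) →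
             (∀ {v} → v ∈ᵗ t → ¬ (v ∈ᶠ F)) → ∃[ F' ] leavesᶠ F < leavesᶠ F'
    follow ε t only _ = contradiction (sym (only (root∈ᵗ t) Aa')) a≢a'
    follow (_◅_ {j = y} (e , _ , y∉) walk) t only disj with y ∈ᶠ? F
    ... | yes y∈F with insertᶠ (E-sym e) t F y∈F y∉ disj
    ...   | F' , _ , same = F' , ℕ.≤-trans (ℕ.+-monoˡ-≤ (leavesᶠ F) (leaves>0 t)) (ℕ.≤-reflexive (sym same))
    follow (_◅_ {j = y} (e , _ , y∉) walk) t only disj | no y∉F with y ∈ᵗ? t
    ... | yes y∈t with subtree t y∈t
    ...   | t' , ⊆t = follow walk t' (only ∘ ⊆t) (disj ∘ ⊆t)
    follow (_◅_ {j = y} (e , _ , y∉) walk) t only disj | no y∉F | no y∉t with A? y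
    ... | yes Ay = add Ay (E-sym e) t y∉t F y∉F disj , ℕ.+-monoˡ-≤ (leavesᶠ F) (leaves>0 t)
    ... | no ¬Ay = follow walk (step ¬Ay (E-sym e) t y∉t)
      (λ { (inj₁ refl) Ay → contradiction Ay ¬Ay ; (inj₂ v∈) → only v∈ })
      (λ { (inj₁ refl) → y∉F ; (inj₂ v∈) → disj v∈ })

  Hits : (Fin n → Set) → Set
  Hits X = ∀ {a a'} → A a → A a' → ¬ X a → Star (Avoid E X) a a' → a ≡ a'

  -- Each round gains a leaf, and `fuel` covers the leaves missing to `k + k`. That many leaves
  -- yield `k` A-paths. If growth stops earlier, every A-path meets a special vertex, and there are
  -- at most twice as many of these as leaves.
  packOrHit : ∀ k → (Σ (Packing (λ v → v ≡ v)) λ p → k ≤ size p) ⊎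
              ∃[ S ] (length S ≤ (k + k) + (k + k) × Hits (_∈ S))
  packOrHit k = search (k + k) [] (ℕ.m≤m+n (k + k) 0)
    where
    search : ∀ fuel F → k + k ≤ fuel + leavesᶠ F → (Σ (Packing (λ v → v ≡ v)) λ p → k ≤ size p) ⊎
             ∃[ S ] (length S ≤ (k + k) + (k + k) × Hits (_∈ S))
    search fuel F ≤fuel with k + k ℕ.≤? leavesᶠ F
    ... | yes many with extractᶠ F
    ...   | p , enough = inj₁ (relax (λ _ → refl) p , halve-≤ (ℕ.≤-trans many enough))
    search zero F ≤fuel | no few = contradiction ≤fuel few
    search (suc fuel) F ≤fuel | no few
      with Fin.any? (λ a → Fin.any? (λ a' → A? a ×-dec A? a' ×-dec ¬? (a Fin.≟ a') ×-dec ¬? (a ∈? specialᶠ F) ×-dec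
             star? (λ u v → E? u v ×-dec ¬? (u ∈? specialᶠ F) ×-dec ¬? (v ∈? specialᶠ F)) a a'))
    ... | yes (a , a' , Aa , Aa' , a≢a' , a∉ , walk) with grow F Aa Aa' a≢a' a∉ walk
    ...   | F' , more = search fuel F'
      (ℕ.≤-trans ≤fuel (ℕ.≤-trans (ℕ.≤-reflexive (sym (ℕ.+-suc fuel _))) (ℕ.+-monoʳ-≤ fuel more)))
    search (suc fuel) F ≤fuel | no few | no ∄ =
      inj₂ (specialᶠ F , ℕ.≤-trans (∣specialᶠ∣ F) (ℕ.+-mono-≤ (ℕ.≰⇒≥ few) (ℕ.≰⇒≥ few)) ,
        λ {a} {a'} Aa Aa' a∉ walk → decidable-stable (a Fin.≟ a') λ a≢a' → ∄ (a , a' , Aa , Aa' , a≢a' , a∉ , walk))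

  lookup-apart : ∀ {bs} → AllPairs Apart bs → ∀ i j {v} → region (List.lookup bs i) v → region (List.lookup bs j) v → i ≡ j
  lookup-apart (_ ∷ _) zero zero _ _ = refl
  lookup-apart (ap ∷ _) zero (suc j) v∈ v∈' = contradiction v∈' (All.lookup ap (∈.∈-lookup j) _ v∈)
  lookup-apart (ap ∷ _) (suc i) zero v∈ v∈' = contradiction v∈ (All.lookup ap (∈.∈-lookup i) _ v∈')
  lookup-apart (_ ∷ aps) (suc i) (suc j) v∈ v∈' = cong suc (lookup-apart aps i j v∈ v∈')

-- Contractions of quotients

-- All vertices lie in the top bag of the vertex `x` whose top has the largest index: by `helly` the
-- alternative is that `x` lies in the bag of `top y`, and then the two tops agree.
clique-bound : ∀ {q K} (D : TopDec q) → (∀ a b → a ≢ b → TopDec.Touch D a b) →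
               (∀ t → AtMost K (TopDec.bag D t)) → q ≤ K
clique-bound {zero} D _ _ = z≤n
clique-bound {suc q} D clique small
  with argmin (λ x → x Fin.≟ x) (λ x → m tree ℕ.∸ toℕ (top x)) (zero , refl)
  where open TopDec D
... | x , _ , deepest = atMost-Fin (atMost-mono ℕ.≤-refl (λ {y} _ → everyone y) (small (top x)))
  where
  open TopDec D
  everyone : ∀ y → bag (top x) y
  everyone y with x Fin.≟ y
  ... | yes refl = top∈ x
  ... | no x≢y with helly (clique x y x≢y)
  ...   | inj₁ y∈ = y∈
  ...   | inj₂ x∈ = subst (λ t → bag t y) (Fin.toℕ-injective (ℕ.≤-antisym
          (ℕ.∸-cancelʳ-≤ (Fin.toℕ≤pred[n] (top y)) (deepest y refl)) (top-≤ x∈))) (top∈ y)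

module _ (H : CGraph) where
  open CGraph H renaming (sym to adj-sym)
  open SpasmMap

  edge? : ∀ u v → Dec (Edge H u v)
  edge? u v = adj u v Bool.≟ true

  edge-sym : ∀ {u v} → Edge H u v → Edge H v u
  edge-sym {u} {v} = trans (adj-sym v u)

  quotEdge? : ∀ {m} (s : SpasmMap H m) a b → Dec (QuotEdge H s a b)
  quotEdge? s a b = Fin.any? (λ u → Fin.any? (λ v → f s u Fin.≟ a ×-dec f s v Fin.≟ b ×-dec edge? u v))

  -- The block of `v₀` is redirected to the block of `u₀`, and its index `b` is removed by
  -- `punchOut`.
  identify : ∀ {m} (s : SpasmMap H (suc m)) {u₀ v₀} → col u₀ ≡ col v₀ → f s u₀ ≢ f s v₀ → ¬ QuotEdge H s (f s u₀) (f s v₀) →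
             Σ (SpasmMap H m) λ s' → ∀ {u v} → f s' u ≡ f s' v →
               f s u ≡ f s v ⊎ (f s u ≡ f s u₀ × f s v ≡ f s v₀) ⊎ (f s u ≡ f s v₀ × f s v ≡ f s u₀)
  identify {m} s {u₀} {v₀} col≡ a≢b ¬adj = record
    { f = f' ; surj = surj'
    ; mono = λ u v eq → same-col (classes eq)
    ; indep = λ u v eq e → independent (classes eq) e
    } , classes
    where
    a b : Fin (suc m)
    a = f s u₀
    b = f s v₀
    redirect : ∀ x → Dec (b ≡ x) → ∃[ y ] b ≢ y
    redirect x (yes _) = a , a≢b ∘ sym
    redirect x (no b≢x) = x , b≢x
    f' : Fin n → Fin m
    f' v = punchOut (proj₂ (redirect (f s v) (b Fin.≟ f s v)))
    surj' : ∀ c → ∃[ v ] f' v ≡ c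
    surj' c with surj s (punchIn b c)
    ... | v , fv≡ = v , trans (Fin.punchOut-cong b (hit (f s v) fv≡ (b Fin.≟ f s v))) (Fin.punchOut-punchIn b)
      where
      hit : ∀ x → x ≡ punchIn b c → ∀ d → proj₁ (redirect x d) ≡ punchIn b c
      hit x x≡ (yes b≡x) = contradiction (sym (trans b≡x x≡)) (Fin.punchInᵢ≢i b c)
      hit x x≡ (no _) = x≡
    Classes : Fin (suc m) → Fin (suc m) → Set
    Classes x y = x ≡ y ⊎ (x ≡ a × y ≡ b) ⊎ (x ≡ b × y ≡ a)
    redirect-classes : ∀ x y d d' → proj₁ (redirect x d) ≡ proj₁ (redirect y d') → Classes x y
    redirect-classes x y (yes b≡x) (yes b≡y) _ = inj₁ (trans (sym b≡x) b≡y)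
    redirect-classes x y (yes b≡x) (no _) a≡y = inj₂ (inj₂ (sym b≡x , sym a≡y))
    redirect-classes x y (no _) (yes b≡y) x≡a = inj₂ (inj₁ (x≡a , sym b≡y))
    redirect-classes x y (no _) (no _) x≡y = inj₁ x≡y
    classes : ∀ {u v} → f' u ≡ f' v → Classes (f s u) (f s v)
    classes {u} {v} eq = redirect-classes _ _ (b Fin.≟ f s u) (b Fin.≟ f s v) (Fin.punchOut-injective
      (proj₂ (redirect (f s u) (b Fin.≟ f s u))) (proj₂ (redirect (f s v) (b Fin.≟ f s v))) eq)
    same-col : ∀ {u v} → Classes (f s u) (f s v) → col u ≡ col v
    same-col (inj₁ eq) = mono s _ _ eq
    same-col (inj₂ (inj₁ (u≡ , v≡))) = trans (mono s _ _ u≡) (trans col≡ (sym (mono s _ _ v≡)))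
    same-col (inj₂ (inj₂ (u≡ , v≡))) = trans (mono s _ _ u≡) (trans (sym col≡) (sym (mono s _ _ v≡)))
    independent : ∀ {u v} → Classes (f s u) (f s v) → ¬ Edge H u v
    independent (inj₁ eq) e = indep s _ _ eq e
    independent (inj₂ (inj₁ (u≡ , v≡))) e = ¬adj (_ , _ , u≡ , v≡ , e)
    independent (inj₂ (inj₂ (u≡ , v≡))) e = ¬adj (_ , _ , v≡ , u≡ , edge-sym e)

  -- Identifying nonadjacent blocks with the same label as long as possible
  -- makes the blocks of each label pairwise adjacent.
  saturate : ∀ {Same : Rel n} → (∀ u v → Dec (Same u v)) → (∀ {v} → Same v v) → (∀ {u v} → Same u v → Same v u) →
             (∀ {u v w} → Same u v → Same v w → Same u w) → (∀ {u v} → Same u v → col u ≡ col v) →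
             ∃[ m ] Σ (SpasmMap H m) λ s → (∀ {u v} → f s u ≡ f s v → Same u v) ×
               (∀ {u v} → Same u v → f s u ≡ f s v ⊎ QuotEdge H s (f s u) (f s v))
  saturate {Same} same? s-refl s-sym s-trans s-col = go n discrete λ { refl → s-refl }
    where
    discrete : SpasmMap H n
    discrete = record { f = id ; surj = λ v → v , refl ; mono = λ _ _ → cong col
                      ; indep = λ { u _ refl e → case trans (sym (irr u)) e of λ () } }
    go : ∀ m (s : SpasmMap H m) → (∀ {u v} → f s u ≡ f s v → Same u v) →
         ∃[ m ] Σ (SpasmMap H m) λ s → (∀ {u v} → f s u ≡ f s v → Same u v) ×
           (∀ {u v} → Same u v → f s u ≡ f s v ⊎ QuotEdge H s (f s u) (f s v))
    go m s refines with Fin.any? (λ u → Fin.any? (λ v →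
        same? u v ×-dec ¬? (f s u Fin.≟ f s v) ×-dec ¬? (quotEdge? s (f s u) (f s v))))
    go m s refines | no ∄ = m , s , refines , saturated
      where
      saturated : ∀ {u v} → Same u v → f s u ≡ f s v ⊎ QuotEdge H s (f s u) (f s v)
      saturated {u} {v} same with f s u Fin.≟ f s v | quotEdge? s (f s u) (f s v)
      ... | yes eq | _ = inj₁ eq
      ... | no _ | yes e = inj₂ e
      ... | no u≢v | no ¬e = contradiction (u , v , same , u≢v , ¬e) ∄
    go zero s refines | yes (u , _) = case f s u of λ ()
    go (suc m) s refines | yes (u₀ , v₀ , same , u₀≢v₀ , ¬e) with identify s (s-col same) u₀≢v₀ ¬e
    ... | s' , classes = go m s' λ eq → merged (classes eq)
      where
      merged : ∀ {u v} → f s u ≡ f s v ⊎ (f s u ≡ f s u₀ × f s v ≡ f s v₀) ⊎ (f s u ≡ f s v₀ × f s v ≡ f s u₀) → Same u v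
      merged (inj₁ eq) = refines eq
      merged (inj₂ (inj₁ (u≡ , v≡))) = s-trans (refines u≡) (s-trans same (s-sym (refines v≡)))
      merged (inj₂ (inj₂ (u≡ , v≡))) = s-trans (refines u≡) (s-trans (s-sym same) (s-sym (refines v≡)))

  -- Φ is a minor model in H^•: the branch set of b is the fibre of just b, and the
  -- vertices sent to nothing are unused.
  module _ {q} (Φ : Fin n → Maybe (Fin q)) where

    FibreEdge : Fin q → Rel n
    FibreEdge b u v = Φ u ≡ just b × Φ v ≡ just b × EdgeBullet H u v

    -- Saturation within each colour of each fibre turns the clique edges of H^• inside branch sets
    -- into identities or edges of the quotient, so the branch sets stay linked in its
    -- decomposition. Each block meets at most one branch set.
    minor : ∀ {c} → (∀ m (s : SpasmMap H m) → TwAtMost m (QuotEdge H s) c) →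
            (∀ {b u v} → Φ u ≡ just b → Φ v ≡ just b → Star (FibreEdge b) u v) →
            Σ (TopDec q) λ D → (∀ t → AtMost (2 + c) (TopDec.bag D t)) ×
              (∀ {u v a b} → Φ u ≡ just a → Φ v ≡ just b → Edge H u v → TopDec.Touch D a b)
    minor {c} bounded connected
      with saturate {λ u v → Φ u ≡ Φ v × col u ≡ col v}
             (λ u v → Maybe.≡-dec Fin._≟_ (Φ u) (Φ v) ×-dec col u Fin.≟ col v)
             (refl , refl) (λ (p , q) → sym p , sym q) (λ (p , q) (p' , q') → trans p p' , trans q q') proj₂
    ... | m , s , refines , saturated with bounded m s
    ...   | TD , small = expansion , expansion-small core-small , touch
      where
      D : TopDec m
      D = fromTreeDec TD
      open TopDec D
      P : Fin q → Fin m → Set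
      P b x = ∃[ v ] (f s v ≡ x × Φ v ≡ just b)
      P? : ∀ b → Decidable (P b)
      P? b x = Fin.any? (λ v → f s v Fin.≟ x ×-dec Maybe.≡-dec Fin._≟_ (Φ v) (just b))
      quot-touch : ∀ {x y} → QuotEdge H s x y → Touch x y
      quot-touch = TreeDec.ecover TD _ _
      linked : ∀ b → Linked D (P b)
      linked b (u , refl , Φu) (v , refl , Φv) = Star.gmap (f s) image (connected Φu Φv)
        where
        image : ∀ {u v} → FibreEdge b u v → P b (f s v) × Touch (f s u) (f s v)
        image {u} {v} (Φu , Φv , inj₁ e) = (v , refl , Φv) , quot-touch (u , v , refl , refl , e)
        image {u} {v} (Φu , Φv , inj₂ (_ , col≡)) = (v , refl , Φv) ,
          [ (λ eq → subst (Touch (f s u)) eq (touch-refl _)) , quot-touch ]′ (saturated (trans Φu (sym Φv) , col≡))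
      nonempty? : ∀ b → Dec (∃ (P b))
      nonempty? b = Fin.any? (P? b)
      -- An empty branch set still needs a bag: it gets a leaf at the root. Hence the bound `2 + c`
      -- instead of `1 + c`.
      core leaf : Node tree → Fin q → Set
      core t b = Meets D (P b) t
      leaf t b = t ≡ zero × ¬ ∃ (P b)
      TopOf : Fin q → Node tree → Set
      TopOf b r = (core r b ⊎ leaf r b) × (∀ {t} → core t b ⊎ leaf t b → t ≢ r → core t b ×
                  ∃[ i ] (t ≡ suc i × (core (RTree.par tree i) b ⊎ nothing ≡ just b × leaf (RTree.par tree i) b)))
      topOf : ∀ b → Dec (∃ (P b)) → ∃ (TopOf b)
      topOf b (no empty) = zero , inj₂ (refl , empty) ,
        λ { (inj₁ (x , Px , _)) _ → contradiction (x , Px) empty ; (inj₂ (refl , _)) t≢ → contradiction refl t≢ }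
      topOf b (yes some) = proj₁ ct , inj₁ (proj₁ (proj₂ ct)) ,
        λ { (inj₁ t∈) t≢ → t∈ , upwards (proj₂ (proj₂ ct) t∈ t≢)
          ; (inj₂ (_ , empty)) _ → contradiction some empty }
        where
        ct : ∃ (IsTop D (P b))
        ct = classTop D (P? b) some (linked b)
        upwards : ∀ {t} → ∃[ i ] (t ≡ suc i × ∃[ x ] (P b x × bag (suc i) x × bag (RTree.par tree i) x)) →
                  ∃[ i ] (t ≡ suc i × (core (RTree.par tree i) b ⊎ nothing ≡ just b × leaf (RTree.par tree i) b))
        upwards (i , t≡ , x , Px , _ , x∈) = i , t≡ , inj₁ (x , Px , x∈)
      rooted : ∀ b → ∃ (TopOf b)
      rooted b = topOf b (nonempty? b)
      open StarExpansion tree {core} {leaf} (meets? D P?) (λ t b → t Fin.≟ zero ×-dec ¬? (nonempty? b))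
        (λ _ → nothing) (λ b → proj₁ (rooted b)) (λ b → proj₁ (proj₂ (rooted b))) (λ {b} → proj₂ (proj₂ (rooted b)))
      core-small : ∀ t → AtMost (suc c) (core t)
      core-small t = atMost-mono ℕ.≤-refl (λ (x , Px , x∈) → x , x∈ , Px)
        (atMost-⋃₁ (∣∣≤⇒atMost _ (small t)) λ x → atMost-unique (λ b → P? b x)
          λ (u , fu , Φu) (v , fv , Φv) → Maybe.just-injective (trans (sym Φu) (trans (proj₁ (refines (trans fu (sym fv)))) Φv)))
      touch : ∀ {u v a b} → Φ u ≡ just a → Φ v ≡ just b → Edge H u v → TopDec.Touch expansion a b
      touch {u} {v} Φu Φv e with quot-touch (u , v , refl , refl , e)
      ... | t , u∈ , v∈ = expansion-touch t (f s u , (u , refl , Φu) , u∈) (inj₁ (f s v , (v , refl , Φv) , v∈))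

  hat-treewidth : ∀ {c} → (∀ m (s : SpasmMap H m) → TwAtMost m (QuotEdge H s) c) → TwAtMost k (HatEdge H) (suc c)
  hat-treewidth {c} bounded = decompose (minor (just ∘ col) bounded clique)
    where
    decompose : (Σ (TopDec k) λ D → (∀ t → AtMost (2 + c) (TopDec.bag D t)) ×
                  (∀ {u v a b} → just (col u) ≡ just a → just (col v) ≡ just b → Edge H u v → TopDec.Touch D a b)) →
                TwAtMost k (HatEdge H) (suc c)
    decompose (D , small , touch) = TopDec.twAtMost D (λ { i j (_ , u , v , refl , refl , e) → touch refl refl e }) small
    clique : ∀ {b u v} → just (col u) ≡ just b → just (col v) ≡ just b → Star (FibreEdge (just ∘ col) b) u v
    clique {u = u} {v} u≡ v≡ with u Fin.≟ v
    ... | yes refl = ε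
    ... | no u≢v = (u≡ , v≡ , inj₂ (u≢v , Maybe.just-injective (trans u≡ (sym v≡)))) ◅ ε

  -- The q² petals of a flower, indexed by ordered pairs, form a model of K_q:
  -- branch set x consists of the petals (x , y) except their last vertices,
  -- and of the last vertices of the petals (y , x).
  flower-bound : ∀ {c q i} → (∀ m (s : SpasmMap H m) → TwAtMost m (QuotEdge H s) c) → Flower H (q * q) i → q ≤ 2 + c
  flower-bound {c} {q} {i} bounded flower = let D , small , touch = minor Φ bounded connected in
    clique-bound D (adjacent D touch) small
    where
    open Flower flower
    centre : ∀ a → (j : Fin (2 + len a)) → Dec (fromℕ (suc (len a)) ≡ j) → Fin q
    centre a j (yes _) = proj₂ (remQuot {q} q a)
    centre a j (no _) = proj₁ (remQuot {q} q a)
    centre' : ∀ a → Fin (2 + len a) → Fin q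
    centre' a j = centre a j (fromℕ _ Fin.≟ j)
    onPetal? : ∀ v → Dec (∃[ a ] ∃[ j ] p a j ≡ v)
    onPetal? v = Fin.any? (λ a → Fin.any? (λ j → p a j Fin.≟ v))
    Φ : Fin n → Maybe (Fin q)
    Φ v with onPetal? v
    ... | yes (a , j , _) = just (centre' a j)
    ... | no _ = nothing
    Φ⁺ : ∀ a j → Φ (p a j) ≡ just (centre' a j)
    Φ⁺ a j with onPetal? (p a j)
    ... | no ∄ = contradiction (a , j , refl) ∄
    ... | yes (a' , j' , eq) with inj a' a j' j eq
    ...   | refl with injPath a j' j eq
    ...     | refl = refl
    stem : ∀ a (j : Fin (suc (len a))) → Φ (p a (inject₁ j)) ≡ just (proj₁ (remQuot {q} q a))
    stem a j = trans (Φ⁺ a (inject₁ j)) (cong just (notLast (fromℕ _ Fin.≟ inject₁ j)))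
      where
      notLast : ∀ d → centre a (inject₁ j) d ≡ proj₁ (remQuot {q} q a)
      notLast (yes eq) = contradiction eq Fin.fromℕ≢inject₁
      notLast (no _) = refl
    tip : ∀ a → Φ (p a (fromℕ (suc (len a)))) ≡ just (proj₂ (remQuot {q} q a))
    tip a = trans (Φ⁺ a (fromℕ _)) (cong just (isLast (fromℕ (suc (len a)) Fin.≟ fromℕ (suc (len a)))))
      where
      isLast : ∀ d → centre a (fromℕ _) d ≡ proj₂ (remQuot {q} q a)
      isLast (yes _) = refl
      isLast (no ¬last) = contradiction refl ¬last
    onPetal : ∀ v {b} → Φ v ≡ just b → ∃[ a ] ∃[ j ] p a j ≡ v
    onPetal v Φv with onPetal? v
    ... | yes petal = petal
    onPetal v () | no _
    reversed : ∀ {u v} → EdgeBulletExcept H i u v → EdgeBullet H v u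
    reversed (inj₁ e) = inj₁ (edge-sym e)
    reversed (inj₂ (u≢v , col≡ , _)) = inj₂ (u≢v ∘ sym , sym col≡)
    bullet-sym : ∀ {b u v} → FibreEdge Φ b u v → FibreEdge Φ b v u
    bullet-sym (Φu , Φv , inj₁ e) = Φv , Φu , inj₁ (edge-sym e)
    bullet-sym (Φu , Φv , inj₂ (u≢v , col≡)) = Φv , Φu , inj₂ (u≢v ∘ sym , sym col≡)
    -- The last vertex of a petal is in C_i itself; any other vertex walks back along its petal to
    -- the start. As C_i is a clique of H^•, this makes the branch sets connected.
    toCentre : ∀ {v b} → ∃[ a ] ∃[ j ] p a j ≡ v → Φ v ≡ just b →
               ∃[ w ] (col w ≡ i × Φ w ≡ just b × Star (FibreEdge Φ b) v w)
    toCentre (a , j , refl) Φv with fromℕ (suc (len a)) Fin.≟ j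
    ... | yes refl = p a j , end a , Φv , ε
    ... | no j≢ = p a zero , start a , trans (stem a zero) b≡ ,
      subst₂ (λ j b → Star (FibreEdge Φ b) (p a j) (p a zero)) (Fin.inject₁-lower₁ j j≢') (Maybe.just-injective b≡)
        (<-weakInduction (λ j → Star (FibreEdge Φ _) (p a (inject₁ j)) (p a zero)) ε
          (λ j walk → (stem a (suc j) , stem a (inject₁ j) , reversed (step a (inject₁ j))) ◅ walk) (Fin.lower₁ j j≢'))
      where
      j≢' : suc (len a) ≢ toℕ j
      j≢' eq = j≢ (Fin.toℕ-injective (trans (Fin.toℕ-fromℕ _) eq))
      b≡ : just (proj₁ (remQuot {q} q a)) ≡ just _
      b≡ = trans (sym (trans (cong Φ (cong (p a) (sym (Fin.inject₁-lower₁ j j≢')))) (stem a (Fin.lower₁ j j≢')))) Φv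
    connected : ∀ {b u v} → Φ u ≡ just b → Φ v ≡ just b → Star (FibreEdge Φ b) u v
    connected {b} {u} {v} Φu Φv with toCentre (onPetal u Φu) Φu | toCentre (onPetal v Φv) Φv
    ... | w , cw , Φw , u⇝w | w' , cw' , Φw' , v⇝w' = u⇝w ◅◅ across ◅◅ Star.reverse bullet-sym v⇝w'
      where
      across : Star (FibreEdge Φ b) w w'
      across with w Fin.≟ w'
      ... | yes refl = ε
      ... | no w≢w' = (Φw , Φw' , inj₂ (w≢w' , trans cw (sym cw'))) ◅ ε
    -- The last edge of the petal `(x , y)` joins the branch sets of `x` and `y`. It ends in C_i,
    -- where H^{•∖i} has no clique edges, so it is an edge of H.
    adjacent : ∀ (D : TopDec q) → (∀ {u v x y} → Φ u ≡ just x → Φ v ≡ just y → Edge H u v → TopDec.Touch D x y) →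
               ∀ x y → x ≢ y → TopDec.Touch D x y
    adjacent D touch x y _ = touch (trans (stem a (fromℕ (len a))) (cong (just ∘ proj₁) (Fin.remQuot-combine x y)))
      (trans (tip a) (cong (just ∘ proj₂) (Fin.remQuot-combine x y))) (last-edge (step a (fromℕ (len a))))
      where
      a : Fin (q * q)
      a = combine x y
      last-edge : ∀ {u} → EdgeBulletExcept H i u (p a (fromℕ (suc (len a)))) → Edge H u (p a (fromℕ (suc (len a))))
      last-edge (inj₁ e) = e
      last-edge (inj₂ (_ , col≡ , col≢)) = contradiction (trans col≡ (end a)) col≢

atMost-1⇒≡ : ∀ {A : Set} {P : A → Set} → AtMost 1 P → ∀ {u v} → P u → P v → u ≡ v
atMost-1⇒≡ ([] , _ , P⇒) Pu _ = case P⇒ Pu of λ ()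
atMost-1⇒≡ (x ∷ [] , _ , P⇒) Pu Pv with P⇒ Pu | P⇒ Pv
... | here refl | here refl = refl
atMost-1⇒≡ (_ ∷ _ ∷ _ , s≤s () , _)

-- From guarded decompositions to quotients

module _ (H : CGraph) where
  open CGraph H using (n; col)
  open SpasmMap

  -- The bag of t in the quotient consists of the blocks meeting g(t), and every
  -- other block meeting β(t) gets its own leaf at t.
  spasm-treewidth : ∀ {c} → GuardedDec H c → ∀ q (s : SpasmMap H q) → TwAtMost q (QuotEdge H s) c
  spasm-treewidth {c} G q s = TopDec.twAtMost expansion touch (expansion-small core-small)
    where
    open GuardedDec G renaming (Node to GNode)
    D : TopDec n
    D = fromTreeDec dec
    P : Fin q → Fin n → Set
    P b v = f s v ≡ b
    P? : ∀ b → Decidable (P b)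
    P? b v = f s v Fin.≟ b
    -- A block is monochromatic, hence a clique of H^•.
    linked : ∀ b → Linked D (P b)
    linked b {u} {v} fu fv with u Fin.≟ v
    ... | yes refl = ε
    ... | no u≢v = (fv , ecover u v (inj₂ (u≢v , mono s u v (trans fu (sym fv))))) ◅ ε
    core leaf : GNode → Fin q → Set
    core t b = ∃[ v ] (f s v ≡ b × v ∈ˢ g t)
    leaf t b = Meets D (P b) t
    core⇒leaf : ∀ {t b} → core t b → leaf t b
    core⇒leaf {t} (v , fv , v∈) = v , fv , g⊆β t v∈
    outside : Fin (RTree.m tree) → Subset n
    outside i = sigma tree bag (suc i) ─ g (RTree.par tree i)
    -- Condition (ii) leaves at most one vertex of the adhesion set unguarded at the parent; the
    -- subtree is hung at the leaf of the block of this vertex.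
    attach : ∀ i → Dec (∃ (_∈ˢ outside i)) → Maybe (Fin q)
    attach i (yes (v , _)) = just (f s v)
    attach i (no _) = nothing
    attach≡ : ∀ i d {u} → u ∈ˢ outside i → attach i d ≡ just (f s u)
    attach≡ i (yes (v , v∈)) u∈ = cong (just ∘ f s) (atMost-1⇒≡ (∣∣≤⇒atMost (outside i) (cutv i)) v∈ u∈)
    attach≡ i (no ∄) {u} u∈ = contradiction (u , u∈) ∄
    outside? : ∀ i → Dec (∃ (_∈ˢ outside i))
    outside? i = Fin.any? (Subset._∈? outside i)
    ct : ∀ b → ∃ (IsTop D (P b))
    ct b = classTop D (P? b) (surj s b) (linked b)
    climbs : ∀ {b t} → core t b ⊎ leaf t b → t ≢ proj₁ (ct b) → core t b × ∃[ i ] (t ≡ suc i ×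
             (core (RTree.par tree i) b ⊎ attach i (outside? i) ≡ just b × leaf (RTree.par tree i) b))
    climbs {b} t∈ t≢ with proj₂ (proj₂ (ct b)) ([ core⇒leaf , id ]′ t∈) t≢
    -- The vertex `u` of the block is in the adhesion set: it is guarded at `t` by `σ⊆g`, and at the
    -- parent it is guarded or the single exception.
    ... | i , refl , u , refl , u∈ , u∈p = (u , refl , σ⊆g (suc i) u∈σ) , i , refl , upper
      where
      u∈σ : u ∈ˢ sigma tree bag (suc i)
      u∈σ = Subset.x∈p∩q⁺ (u∈ , u∈p)
      upper : core (RTree.par tree i) (f s u) ⊎ attach i (outside? i) ≡ just (f s u) × leaf (RTree.par tree i) (f s u)
      upper with u Subset.∈? g (RTree.par tree i)
      ... | yes u∈g = inj₁ (u , refl , u∈g)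
      ... | no u∉g = inj₂ (attach≡ i (outside? i) (Subset.x∈p∧x∉q⇒x∈p─q u∈σ u∉g) , u , refl , u∈p)
    open StarExpansion tree {core} {leaf} (λ t b → Fin.any? (λ v → P? b v ×-dec v Subset.∈? g t)) (meets? D P?)
      (λ i → attach i (outside? i)) (λ b → proj₁ (ct b)) (λ b → inj₂ (proj₁ (proj₂ (ct b)))) climbs
    core-small : ∀ t → AtMost c (core t)
    core-small t = atMost-mono ℕ.≤-refl (λ (v , fv , v∈) → v , v∈ , sym fv)
      (atMost-⋃₁ (∣∣≤⇒atMost (g t) (guard t)) (λ v → atMost-point (f s v)))
    touch : ∀ a b → QuotEdge H s a b → TopDec.Touch expansion a b
    touch a b (u , v , fu , fv , e) with ecover u v (inj₁ e)
    ... | t , u∈ , v∈ with vc t u v u∈ v∈ e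
    ...   | inj₁ u∈g = expansion-touch t (u , fu , u∈g) (inj₂ (v , fv , v∈))
    ...   | inj₂ v∈g = TopDec.touch-sym expansion (expansion-touch t (v , fv , v∈g) (inj₂ (u , fu , u∈)))

-- Refinement of a tree decomposition into components

-- A node (t , v) stands for the component of v in the subgraph induced by the
-- vertices whose topmost bag is at t or below, v being its least vertex; its bag
-- is the part of the bag of t in or adjacent to this component. All other pairs
-- (t , v), and an additional root, get empty bags.
module Refinement {n} {E : Rel n} (E? : ∀ u v → Dec (E u v)) (E-sym : ∀ {u v} → E u v → E v u)
                  (B : TopDec n) (cover : ∀ {u v} → E u v → TopDec.Touch B u v) where
  open TopDec B
  private
    M : ℕ
    M = RTree.m tree
    π : Fin M → Node tree
    π = RTree.par tree

  Below : Node tree → Fin n → Set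
  Below t u = Desc tree t (top u)

  Joined : Node tree → Rel n
  Joined t u w = E u w × Below t u × Below t w

  private
    joined? : ∀ t u w → Dec (Joined t u w)
    joined? t u w = E? u w ×-dec Desc? t (top u) ×-dec Desc? t (top w)

    joined-sym : ∀ {t u w} → Joined t u w → Joined t w u
    joined-sym (e , u , w) = E-sym e , w , u

    joined-par : ∀ {i u w} → Joined (suc i) u w → Joined (π i) u w
    joined-par (e , u , w) = e , Desc-trans (child self) u , Desc-trans (child self) w

    reach-below : ∀ {t u w} → Below t u → Star (Joined t) u w → Below t w
    reach-below u ε = u
    reach-below u ((_ , _ , w) ◅ walk) = reach-below w walk

    least : ∀ t v → ∃[ w ] (Star (Joined t) v w × ∀ u → Star (Joined t) v u → toℕ w ≤ toℕ u)
    least t v = argmin (star? (joined? t) v) toℕ (v , ε)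

    rep : Node tree → Fin n → Fin n
    rep t v = proj₁ (least t v)

    reach-rep : ∀ t v → Star (Joined t) v (rep t v)
    reach-rep t v = proj₁ (proj₂ (least t v))

    rep-cong : ∀ {t u v} → Star (Joined t) u v → rep t u ≡ rep t v
    rep-cong {t} {u} {v} walk = Fin.toℕ-injective (ℕ.≤-antisym
      (proj₂ (proj₂ (least t u)) _ (walk ◅◅ reach-rep t v))
      (proj₂ (proj₂ (least t v)) _ (Star.reverse joined-sym walk ◅◅ reach-rep t u)))

    node : Node tree × Fin n → Fin (suc M * n)
    node (t , v) = combine t v

    split : Fin (suc M * n) → Node tree × Fin n
    split = remQuot n

    node-split : ∀ y → node (split y) ≡ y
    node-split = Fin.combine-remQuot {suc M} n

    parent : Node tree × Fin n → Fin (suc (suc M * n))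
    parent (zero , v) = zero
    parent (suc i , v) = suc (node (π i , rep (π i) v))

    parent-≤ : ∀ tv → toℕ (parent tv) ≤ toℕ (node tv)
    parent-≤ (zero , v) = z≤n
    parent-≤ (suc i , v) = Fin.combine-monoˡ-< (rep (π i) v) v (s≤s (RTree.par-lt tree i))

    refinedTree : RTree
    refinedTree = record
      { m = suc M * n
      ; par = λ y → parent (split y)
      ; par-lt = λ y → subst (λ z → toℕ (parent (split y)) ≤ toℕ z) (node-split y) (parent-≤ (split y))
      }

    Attached : Node tree → Fin n → Fin n → Set
    Attached t v u = ∃[ w ] (Star (Joined t) v w × (w ≡ u ⊎ E w u))

    Bag : Node tree × Fin n → Fin n → Set
    Bag (t , v) u = (Below t v × rep t v ≡ v) × bag t u × Attached t v u

    Bag? : ∀ tv u → Dec (Bag tv u)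
    Bag? (t , v) u = (Desc? t (top v) ×-dec rep t v Fin.≟ v) ×-dec bag? t u ×-dec
                     Fin.any? (λ w → star? (joined? t) v w ×-dec (w Fin.≟ u ⊎-dec E? w u))

    RBag : Node refinedTree → Fin n → Set
    RBag zero u = ⊥
    RBag (suc y) u = Bag (split y) u

    at-node : ∀ tv {u} → Bag tv u → RBag (suc (node tv)) u
    at-node (t , v) {u} = subst (λ x → Bag x u) (sym (Fin.remQuot-combine t v))

    valid-rep : ∀ {t v} → Below t v → Below t (rep t v) × rep t (rep t v) ≡ rep t v
    valid-rep {t} {v} v∈ = reach-below v∈ (reach-rep t v) , sym (rep-cong (reach-rep t v))

    from-rep : ∀ t v → Star (Joined t) (rep t v) v
    from-rep t v = Star.reverse joined-sym (reach-rep t v)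

    topNode : Fin n → Node tree × Fin n
    topNode u = top u , rep (top u) u

    -- If `top u` is at `t` or below, `u` belongs to the component and `t` is its top. Otherwise `u`
    -- is also in the bag above, and stays attached to the larger component there.
    toParent : ∀ {u} tv → Bag tv u → tv ≢ topNode u → RBag (parent tv) u
    toParent {u} (t , v) ((v∈ , rep≡) , u∈ , w , walk , adj) ≢top with Desc? t (top u)
    ... | yes below = contradiction (sym (top≡ (Fin.toℕ-injective (ℕ.≤-antisym (top-≤ u∈) (Desc⇒≤ below))))) ≢top
      where
      reached : w ≡ u ⊎ E w u → Star (Joined t) v u
      reached (inj₁ refl) = walk
      reached (inj₂ e) = walk ◅◅ (e , reach-below v∈ walk , below) ◅ ε
      top≡ : top u ≡ t → topNode u ≡ (t , v)
      top≡ refl = cong (top u ,_) (trans (sym (rep-cong (reached adj))) rep≡)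
    ... | no above with climb u∈ (λ t≡ → above (subst (λ s → Desc tree s (top u)) (sym t≡) self))
    ...   | i , refl , u∈' = at-node (π i , rep (π i) v)
            (valid-rep (Desc-trans (child self) v∈) , u∈' , w , from-rep (π i) v ◅◅ Star.map joined-par walk , adj)

  refined : TopDec n
  refined = record
    { tree = refinedTree
    ; bag = RBag
    ; bag? = λ { zero u → no λ () ; (suc y) u → Bag? (split y) u }
    ; top = λ u → suc (node (topNode u))
    ; top∈ = λ u → at-node (topNode u) (valid-rep self , top∈ u , u , from-rep (top u) u , inj₁ refl)
    ; climb = climb'
    }
    where
    climb' : ∀ {u x} → RBag x u → x ≢ suc (node (topNode u)) → ∃[ y ] (x ≡ suc y × RBag (parent (split y)) u)
    climb' {x = suc y} u∈ x≢ = y , refl , toParent (split y) u∈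
      (λ eq → x≢ (cong suc (trans (sym (node-split y)) (cong node eq))))

  refined-touch : ∀ {u v} → E u v → TopDec.Touch refined u v
  refined-touch {u} {v} e with helly (cover e)
  ... | inj₁ v∈ = suc (node (topNode u)) , TopDec.top∈ refined u ,
    at-node (topNode u) (valid-rep self , v∈ , u , from-rep (top u) u , inj₂ e)
  ... | inj₂ u∈ = suc (node (topNode v)) ,
    at-node (topNode v) (valid-rep self , u∈ , v , from-rep (top v) v , inj₂ (E-sym e)) , TopDec.top∈ refined v

  base : Node refinedTree → Maybe (Node tree)
  base zero = nothing
  base (suc y) = just (proj₁ (split y))

  refined⊆ : ∀ {x u} → RBag x u → ∃[ t ] (base x ≡ just t × bag t u)
  refined⊆ {suc y} (_ , u∈ , _) = _ , refl , u∈

  -- A connection with at least one inner vertex and all inner vertices outside `X`; `¬ X w` covers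
  -- the case of exactly one.
  Through : (Fin n → Set) → Rel n
  Through X u u' = ∃[ w ] ∃[ w' ] (E u w × ¬ X w × Star (Avoid E X) w w' × E w' u')

  -- Vertices with top at the child or below are not in the coarse bag of the parent. So `u` and
  -- `u'` are outside the component, are attached to it by edges, and are connected through it.
  adhesion : ∀ {y u u'} → RBag (suc y) u → RBag (RTree.par refinedTree y) u →
             RBag (suc y) u' → RBag (RTree.par refinedTree y) u' →
             ∃[ t ] (base (RTree.par refinedTree y) ≡ just t × bag t u × bag t u' × Through (bag t) u u')
  adhesion {y} = go (split y)
    where
    outside : ∀ {i w} → Below (suc i) w → ¬ bag (π i) w
    outside {i} {w} below w∈ = ℕ.<⇒≱ (s≤s (RTree.par-lt tree i)) (ℕ.≤-trans (Desc⇒≤ below) (top-≤ w∈))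
    neighbour : ∀ {i w u} → Below (suc i) w → bag (π i) u → w ≡ u ⊎ E w u → E w u
    neighbour below u∈ (inj₁ refl) = contradiction u∈ (outside below)
    neighbour below u∈ (inj₂ e) = e
    go : ∀ tv {u u'} → Bag tv u → RBag (parent tv) u → Bag tv u' → RBag (parent tv) u' →
         ∃[ t ] (base (parent tv) ≡ just t × bag t u × bag t u' × Through (bag t) u u')
    go (suc i , v) {u} {u'} ((v∈ , _) , _ , w , walk , adj) u∈ (_ , _ , w' , walk' , adj') u'∈ =
      π i , cong just base≡ , u∈t , u'∈t , w , w' ,
      E-sym (neighbour (reach-below v∈ walk) u∈t adj) , outside (reach-below v∈ walk) ,
      Star.map (λ (e , x , x') → e , outside x , outside x') (Star.reverse joined-sym walk ◅◅ walk') ,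
      neighbour (reach-below v∈ walk') u'∈t adj'
      where
      base≡ : proj₁ (split (node (π i , rep (π i) v))) ≡ π i
      base≡ = cong proj₁ (Fin.remQuot-combine (π i) (rep (π i) v))
      u∈t : bag (π i) u
      u∈t = subst (λ t → bag t u) base≡ (proj₁ (proj₂ u∈))
      u'∈t : bag (π i) u'
      u'∈t = subst (λ t → bag t u') base≡ (proj₁ (proj₂ u'∈))

-- Separators of the colour classes

∉-─ : ∀ {n} {p q : Subset n} {x} → x ∈ˢ p ─ q → ¬ (x ∈ˢ q)
∉-─ {p = _ ∷ _} {true ∷ _} (Vec.there x∈) (Vec.there x∈q) = ∉-─ x∈ x∈q
∉-─ {p = _ ∷ _} {false ∷ _} (Vec.there x∈) (Vec.there x∈q) = ∉-─ x∈ x∈q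

Crosses : ∀ {n} → Rel n → (Fin n → Set) → Fin n → Set
Crosses R Q y = ∃[ u ] ∃[ u' ] (Star R y u × R u u' × Q u × ¬ Q u')

crossing : ∀ {n} {R : Rel n} {Q : Fin n → Set} → Decidable Q → ∀ {y z} → Q y → Star R y z → Q z ⊎ Crosses R Q y
crossing Q? Qy ε = inj₁ Qy
crossing Q? {y} Qy (_◅_ {j = y'} r walk) with Q? y'
... | no ¬Qy' = inj₂ (_ , _ , ε , r , Qy , ¬Qy')
... | yes Qy' with crossing Q? Qy' walk
...   | inj₁ Qz = inj₁ Qz
...   | inj₂ (u , u' , walk' , rest) = inj₂ (u , u' , r ◅ walk' , rest)

avoid-end : ∀ {n} {E : Rel n} {X : Fin n → Set} {u v} → ¬ X u → Star (Avoid E X) u v → ¬ X v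
avoid-end u∉ ε = u∉
avoid-end u∉ ((_ , _ , v∉) ◅ walk) = avoid-end v∉ walk

avoid-reverse : ∀ {n} {E : Rel n} {X : Fin n → Set} → (∀ {u v} → E u v → E v u) →
                ∀ {u v} → Star (Avoid E X) u v → Star (Avoid E X) v u
avoid-reverse E-sym = Star.reverse λ (e , u∉ , v∉) → E-sym e , v∉ , u∉

hitting-bound : ℕ → ℕ
hitting-bound c = (c + c) + (c + c)

-- The near vertices of the hitting set, and at most `suc c` replacements for each far one.
separator-bound : ℕ → ℕ
separator-bound c = hitting-bound c + hitting-bound c * suc c

-- For each colour i of a bag: X_i, and one vertex of C_i for each colour of the bag.
vertex-cover-bound : ℕ → ℕ
vertex-cover-bound c = suc c * (separator-bound c + suc c)

module _ (H : CGraph) where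
  open CGraph H using (n; k; col; irr)

  bullet? : ∀ u v → Dec (EdgeBullet H u v)
  bullet? u v = edge? H u v ⊎-dec ¬? (u Fin.≟ v) ×-dec col u Fin.≟ col v

  bullet-sym : ∀ {u v} → EdgeBullet H u v → EdgeBullet H v u
  bullet-sym (inj₁ e) = inj₁ (edge-sym H e)
  bullet-sym (inj₂ (u≢v , col≡)) = inj₂ (u≢v ∘ sym , sym col≡)

  except? : ∀ i u v → Dec (EdgeBulletExcept H i u v)
  except? i u v = edge? H u v ⊎-dec ¬? (u Fin.≟ v) ×-dec col u Fin.≟ col v ×-dec ¬? (col u Fin.≟ i)

  except-sym : ∀ {i u v} → EdgeBulletExcept H i u v → EdgeBulletExcept H i v u
  except-sym (inj₁ e) = inj₁ (edge-sym H e)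
  except-sym (inj₂ (u≢v , col≡ , col≢)) = inj₂ (u≢v ∘ sym , sym col≡ , λ eq → col≢ (trans col≡ eq))

  module Class (i : Fin k) =
    APaths {E = EdgeBulletExcept H i} (except? i) except-sym {A = λ v → col v ≡ i} (λ v → col v Fin.≟ i)

  -- Each walk is shortened to a simple path inside its region, of positive length because its
  -- endpoints differ.
  packing⇒flower : ∀ {c i P} (p : Class.Packing i P) → c ≤ Class.Packing.size i p → Flower H c i
  packing⇒flower {c} {i} p c≤ = record
    { len = λ a → proj₁ (petal a)
    ; p = λ a → at (path a)
    ; step = λ a j → proj₁ (at-step (path a) j)
    ; start = λ a → trans (cong col (at-first (path a))) (Blob.source∈A (B a))
    ; end = λ a → trans (cong col (at-last (path a))) (Blob.target∈A (B a))
    ; inj = λ a b j j' eq → Fin.inject≤-injective c≤ c≤ a b (lookup-apart apart _ _ (inRegion a j)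
              (subst (Blob.region (B b)) (sym eq) (inRegion b j')))
    ; injPath = λ a → proj₂ (proj₂ (petal a))
    }
    where
    open Class i
    open Packing p
    B : Fin c → Blob
    B a = List.lookup blobs (Fin.inject≤ a c≤)
    Petal : Fin c → Set
    Petal a = ∃[ l ] Σ (Path (Within (Blob.region (B a))) (Blob.source (B a)) (Blob.target (B a)) (suc l)) Simple
    petal : ∀ a → Petal a
    petal a with Star⇒simplePath Fin._≟_ (Blob.walk (B a))
    ... | suc l , path , simple = l , path , simple
    ... | zero , path , _ = contradiction (at-last path) (λ eq → Blob.distinct (B a) (trans (sym (at-first path)) eq))
    path : ∀ a → Path (Within (Blob.region (B a))) (Blob.source (B a)) (Blob.target (B a)) (suc (proj₁ (petal a)))
    path a = proj₁ (proj₂ (petal a))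
    within-region : ∀ {L x y l} (p : Path (Within L) x y (suc l)) j → L (at p j)
    within-region ((_ , x∈ , _) ∷ p) zero = x∈
    within-region ((_ , _ , y∈) ∷ [ _ ]) (suc zero) = y∈
    within-region (_ ∷ (r ∷ p)) (suc j) = within-region (r ∷ p) j
    inRegion : ∀ a j → Blob.region (B a) (at (path a) j)
    inRegion a = within-region (path a)

  -- The choice of the sets X_i: besides hitting all C_i-paths of H^{•∖i}, the
  -- vertices of X_i have colours sharing a bag with i, so that adding X_i to all
  -- bags containing i keeps the bags of a vertex connected.
  record Separator (c : ℕ) (D : TopDec k) (i : Fin k) : Set₁ where
    field
      X    : Fin n → Set
      X?   : Decidable X
      few  : AtMost (separator-bound c) X
      near : ∀ {v} → X v → TopDec.Touch D i (col v)
      hits : Class.Hits i X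

  module _ {c} (D : TopDec k) (small : ∀ t → AtMost (suc c) (TopDec.bag D t))
           (hat : ∀ {i j} → HatEdge H i j → TopDec.Touch D i j) where
    open TopDec D

    touch-col : ∀ {u v} → EdgeBullet H u v → Touch (col u) (col v)
    touch-col {u} {v} (inj₂ (_ , col≡)) = subst (Touch (col u)) col≡ (touch-refl (col u))
    touch-col {u} {v} (inj₁ e) with col u Fin.≟ col v
    ... | yes col≡ = subst (Touch (col u)) col≡ (touch-refl (col u))
    ... | no col≢ = hat (col≢ , u , v , refl , refl , e)

    except⇒bullet : ∀ {i u v} → EdgeBulletExcept H i u v → EdgeBullet H u v
    except⇒bullet (inj₁ e) = inj₁ e
    except⇒bullet (inj₂ (u≢v , col≡ , _)) = inj₂ (u≢v , col≡)

    module NearSeparator (i : Fin k) (S : List (Fin n)) (∣S∣≤ : length S ≤ hitting-bound c)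
                         (S-hits : Class.Hits i (_∈ S)) where
      open DecMembership (Fin._≟_ {n}) using (_∈?_)

      G : Rel n
      G = EdgeBulletExcept H i

      Outside : Rel n
      Outside = Avoid G (_∈ S)

      outside? : ∀ u v → Dec (Outside u v)
      outside? u v = except? i u v ×-dec ¬? (u ∈? S) ×-dec ¬? (v ∈? S)

      Reaches : Fin n → Fin k → Set
      Reaches y d = col y ≡ i × ¬ (y ∈ S) × ∃[ w ] (col w ≡ d × d ≢ i × ¬ (w ∈ S) × Star Outside y w)

      -- As `d` differs from `i`, its class is a clique of H^{•∖i}; two vertices reaching it would
      -- be joined by a C_i-path avoiding `S`.
      reaches-unique : ∀ {d y y'} → Reaches y d → Reaches y' d → y ≡ y'
      reaches-unique (cy , y∉ , w , refl , w≢i , w∉ , walk) (cy' , _ , w' , w≡ , _ , w'∉ , walk') =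
        S-hits cy cy' y∉ (walk ◅◅ across ◅◅ avoid-reverse except-sym walk')
        where
        across : Star Outside w w'
        across with w Fin.≟ w'
        ... | yes refl = ε
        ... | no w≢w' = (inj₂ (w≢w' , sym w≡ , w≢i) , w∉ , w'∉) ◅ ε

      Separates : Node tree → Fin n → Set
      Separates s x = ∀ {y z} → col y ≡ i → ¬ (y ∈ S) → Star Outside y z → G z x → ∃[ d ] (bag s d × Reaches y d)

      inside-bag : ∀ {s u v} → G u v → Desc tree s (top (col u)) → ¬ Desc tree s (top (col v)) → bag s (col v)
      inside-bag e inside outside with touch-col (except⇒bullet e)
      ... | t , u∈ , v∈ = proj₁ (leave v∈ (Desc-trans inside (bag⇒Desc u∈)) outside)

      -- The walk to `x` starts in colour `i` and has to leave the colours with top at or below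
      -- `top i`. The first colour outside is in the bag of `top i`; it is met before `x`, since `i`
      -- and `col x` share no bag.
      separates-top : ∀ {x} → ¬ Touch i (col x) → ¬ Desc tree (top i) (top (col x)) → Separates (top i) x
      separates-top {x} far ¬ij {y} {z} refl y∉ walk e
        with crossing (λ v → Desc? (top i) (top (col v))) self walk
      ... | inj₁ Qz = contradiction (top i , top∈ i , inside-bag e Qz ¬ij) far
      ... | inj₂ (u , u' , walk' , r@(e' , u∉ , u'∉) , Qu , ¬Qu') = col u' , inside-bag e' Qu ¬Qu' ,
        refl , y∉ , u' , refl , (λ eq → ¬Qu' (subst (λ d → Desc tree (top i) (top d)) (sym eq) self)) , u'∉ ,
        walk' ◅◅ r ◅ ε

      -- Here the walk has to enter the subtree of `top (col x)`. The colour just before the first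
      -- entry, which may happen only on the edge to `x`, is in the bag of `top (col x)`.
      separates-below : ∀ {x} → ¬ Touch i (col x) → ¬ Desc tree (top (col x)) (top i) → Separates (top (col x)) x
      separates-below {x} far ¬ji {y} {z} refl y∉ walk e
        with crossing (λ v → ¬? (Desc? (top (col x)) (top (col v)))) ¬ji walk
      ... | inj₁ Qz = last Qz
        where
        last : ¬ Desc tree (top (col x)) (top (col z)) → _
        last Qz = col z , z∈ , refl , y∉ , z , refl , (λ eq → far (_ , subst (bag (top (col x))) eq z∈ , top∈ (col x))) ,
          avoid-end y∉ walk , walk
          where
          z∈ : bag (top (col x)) (col z)
          z∈ = inside-bag (except-sym e) self Qz
      ... | inj₂ (u , u' , walk' , (e' , u∉ , _) , Qu , ¬Qu') = col u , u∈ ,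
        refl , y∉ , u , refl , (λ eq → far (_ , subst (bag (top (col x))) eq u∈ , top∈ (col x))) , u∉ , walk'
        where
        u∈ : bag (top (col x)) (col u)
        u∈ = inside-bag (except-sym e') (decidable-stable (Desc? (top (col x)) (top (col u'))) ¬Qu') Qu

      separating-bag : ∀ {x} → ¬ Touch i (col x) → ∃[ s ] Separates s x
      separating-bag {x} far with Desc? (top i) (top (col x))
      ... | no ¬ij = top i , separates-top far ¬ij
      ... | yes ij with Desc? (top (col x)) (top i)
      ...   | no ¬ji = top (col x) , separates-below far ¬ji
      ...   | yes ji = contradiction (top i , top∈ i ,
                subst (λ t → bag t (col x)) (Fin.toℕ-injective (ℕ.≤-antisym (Desc⇒≤ ji) (Desc⇒≤ ij))) (top∈ (col x))) far

      -- The vertices of C_i replacing a far vertex x of S.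
      Sees : Fin n → Fin n → Set
      Sees x y = ¬ Touch i (col x) × col y ≡ i × ¬ (y ∈ S) × ∃[ z ] (Star Outside y z × G z x)

      sees? : ∀ x y → Dec (Sees x y)
      sees? x y = ¬? (touch? i (col x)) ×-dec col y Fin.≟ i ×-dec ¬? (y ∈? S) ×-dec
                  Fin.any? (λ z → star? outside? y z ×-dec except? i z x)

      sees-few : ∀ x → AtMost (suc c) (Sees x)
      sees-few x with touch? i (col x)
      ... | yes touch = atMost-none (λ (far , _) → far touch)
      ... | no far with separating-bag far
      ...   | s , separates = atMost-mono ℕ.≤-refl (λ (_ , cy , y∉ , z , walk , e) → separates cy y∉ walk e)
              (atMost-⋃₁ (small s) λ d → atMost-unique (λ y → reaches? y d) reaches-unique)
        where
        reaches? : ∀ y d → Dec (Reaches y d)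
        reaches? y d = col y Fin.≟ i ×-dec ¬? (y ∈? S) ×-dec
          Fin.any? (λ w → col w Fin.≟ d ×-dec ¬? (d Fin.≟ i) ×-dec ¬? (w ∈? S) ×-dec star? outside? y w)

      X : Fin n → Set
      X v = (v ∈ S × Touch i (col v)) ⊎ ∃[ x ] (x ∈ S × Sees x v)

      X? : Decidable X
      X? v = (v ∈? S ×-dec touch? i (col v)) ⊎-dec Fin.any? (λ x → x ∈? S ×-dec sees? x v)

      first-hit : ∀ {a z a'} → Star Outside a z → ¬ (z ∈ S) → Star (Avoid G X) z a' →
                  Star Outside a a' ⊎ ∃[ z ] ∃[ x ] (Star Outside a z × G z x × x ∈ S × ¬ X x)
      first-hit walk z∉ ε = inj₁ walk
      first-hit walk z∉ (_◅_ {j = x} (e , _ , x∉X) rest) with x ∈? S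
      ... | yes x∈ = inj₂ (_ , x , walk , e , x∈ , x∉X)
      ... | no x∉ = first-hit (walk ◅◅ (e , z∉ , x∉) ◅ ε) x∉ rest

      separator : Separator c D i
      separator = record
        { X = X ; X? = X?
        ; few = atMost-mono ℕ.≤-refl (λ { (inj₁ (v∈ , _)) → inj₁ v∈ ; (inj₂ v) → inj₂ v })
                  (atMost-∪ S-few (atMost-⋃ S-few sees-few))
        ; near = λ { (inj₁ (_ , touch)) → touch
                   ; (inj₂ (_ , _ , _ , cv , _)) → subst (Touch i) (sym cv) (touch-refl i) }
        ; hits = hits
        }
        where
        S-few : AtMost (hitting-bound c) (_∈ S)
        S-few = S , ∣S∣≤ , id
        hits : Class.Hits i X
        hits {a} {a'} ca ca' a∉X walk = decide (first-hit ε a∉ walk)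
          where
          a∉ : ¬ (a ∈ S)
          a∉ a∈ = a∉X (inj₁ (a∈ , subst (Touch i) (sym ca) (touch-refl i)))
          decide : Star Outside a a' ⊎ ∃[ z ] ∃[ x ] (Star Outside a z × G z x × x ∈ S × ¬ X x) → a ≡ a'
          decide (inj₁ walk') = S-hits ca ca' a∉ walk'
          -- `x` is in `S` but not in `X`, so it is far from `i`; being seen from `a`, it puts `a`
          -- into `X`.
          decide (inj₂ (z , x , walk' , e , x∈ , x∉X)) = contradiction
            (inj₂ (x , x∈ , (λ touch → x∉X (inj₁ (x∈ , touch))) , ca , a∉ , z , walk' , e)) a∉X

    flowerless⇒separator : ∀ i → ¬ Flower H c i → Separator c D i
    flowerless⇒separator i ¬flower with Class.packOrHit i c
    ... | inj₁ (p , c≤) = contradiction (packing⇒flower p c≤) ¬flower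
    ... | inj₂ (S , ∣S∣≤ , hits) = NearSeparator.separator i S ∣S∣≤ hits

-- The guarded cutvertex decomposition

-- The cover at the node itself, and its adhesion set: part of the cover at the parent and at most
-- one further vertex.
guard-bound : ℕ → ℕ
guard-bound c = vertex-cover-bound c + suc (vertex-cover-bound c)

colour-bound : ℕ → ℕ
colour-bound c = suc c * suc (separator-bound c)

module GuardedDecomposition (H : CGraph) {c} (D : TopDec (CGraph.k H)) (small : ∀ t → AtMost (suc c) (TopDec.bag D t))
  (touch : ∀ {u v} → EdgeBullet H u v → TopDec.Touch D (CGraph.col H u) (CGraph.col H v))
  (separator : ∀ i → Separator H c D i) where

  open CGraph H using (n; k; col; irr)
  open TopDec D
  open module S (i : Fin k) = Separator (separator i)

  G : Fin k → Rel n
  G = EdgeBulletExcept H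

  Colours : Fin n → Fin k → Set
  Colours u i = col u ≡ i ⊎ X i u

  colours? : ∀ u i → Dec (Colours u i)
  colours? u i = col u Fin.≟ i ⊎-dec X? i u

  -- The bag of t is the union of C_i ∪ X_i over the colours i in the bag of t.
  coarse : TopDec n
  coarse = contract D colours? (λ u → col u , inj₁ refl) linked
    where
    touch-own : ∀ {u i} → Colours u i → Touch i (col u)
    touch-own (inj₁ refl) = touch-refl _
    touch-own {i = i} (inj₂ u∈) = near i u∈
    -- Any two indices are linked through the own colour of `u`, with which each shares a bag by
    -- `near`.
    linked : ∀ u → Linked D (Colours u)
    linked u Ci Cj = (inj₁ refl , touch-own Ci) ◅ (Cj , touch-sym (touch-own Cj)) ◅ ε

  coarse-touch : ∀ {u v} → EdgeBullet H u v → TopDec.Touch coarse u v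
  coarse-touch {u} {v} e with touch e
  ... | t , u∈ , v∈ = t , (col u , inj₁ refl , u∈) , (col v , inj₁ refl , v∈)

  Meeting : Fin k → Fin k → Fin n → Set
  Meeting i j v = j ≢ i × col v ≡ i × ¬ X i v × ∃[ z ] (col z ≡ j × ¬ X i z × Star (Avoid (G i) (X i)) v z)

  meeting? : ∀ i j v → Dec (Meeting i j v)
  meeting? i j v = ¬? (j Fin.≟ i) ×-dec col v Fin.≟ i ×-dec ¬? (X? i v) ×-dec Fin.any? (λ z → col z Fin.≟ j ×-dec ¬? (X? i z) ×-dec
    star? (λ u v → except? H i u v ×-dec ¬? (X? i u) ×-dec ¬? (X? i v)) v z)

  meeting-unique : ∀ {i j v v'} → Meeting i j v → Meeting i j v' → v ≡ v'
  meeting-unique {i} (j≢i , cv , v∉ , z , refl , z∉ , walk) (_ , cv' , _ , z' , cz' , z'∉ , walk') =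
    hits i cv cv' v∉ (walk ◅◅ across ◅◅ avoid-reverse (except-sym H) walk')
    where
    across : Star (Avoid (G i) (X i)) z z'
    across with z Fin.≟ z'
    ... | yes refl = ε
    ... | no z≢z' = (inj₂ (z≢z' , sym cz' , j≢i) , z∉ , z'∉) ◅ ε

  Cover : Node tree → Fin n → Set
  Cover t v = ∃[ i ] (bag t i × (X i v ⊎ ∃[ j ] (bag t j × Meeting i j v)))

  cover? : ∀ t v → Dec (Cover t v)
  cover? t v = Fin.any? (λ i → bag? t i ×-dec (X? i v ⊎-dec Fin.any? (λ j → bag? t j ×-dec meeting? i j v)))

  cover-few : ∀ t → AtMost (vertex-cover-bound c) (Cover t)
  cover-few t = atMost-⋃ (small t) λ i →
    atMost-∪ (few i) (atMost-⋃₁ (small t) λ j → atMost-unique (meeting? i j) meeting-unique)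

  uncovered : ∀ {t u} → TopDec.bag coarse t u → ¬ Cover t u → bag t (col u) × (∀ {i} → bag t i → ¬ X i u)
  uncovered (i , inj₁ refl , i∈) ¬Y = i∈ , λ i∈' u∈X → ¬Y (_ , i∈' , inj₁ u∈X)
  uncovered (i , inj₂ u∈X , i∈) ¬Y = contradiction (i , i∈ , inj₁ u∈X) ¬Y

  -- If the colours agree, `hits` applies. Otherwise the walk makes `u` the vertex of its class that
  -- meets the class of `u'`, and this vertex is covered.
  uncovered-apart : ∀ {t u u'} → TopDec.bag coarse t u → ¬ Cover t u → TopDec.bag coarse t u' → ¬ Cover t u' →
                    Star (Avoid (G (col u)) (X (col u))) u u' → u ≡ u'
  uncovered-apart {t} {u} {u'} u∈ ¬Yu u'∈ ¬Yu' walk with uncovered u∈ ¬Yu | uncovered u'∈ ¬Yu' | col u' Fin.≟ col u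
  ... | i∈ , u∉ | j∈ , u'∉ | yes same = hits (col u) refl same (u∉ i∈) walk
  ... | i∈ , u∉ | j∈ , u'∉ | no diff = contradiction
    (col u , i∈ , inj₂ (col u' , j∈ , diff , refl , u∉ i∈ , u' , refl , u'∉ i∈ , walk)) ¬Yu

  cover-edge : ∀ {t u v} → TopDec.bag coarse t u → TopDec.bag coarse t v → Edge H u v → Cover t u ⊎ Cover t v
  cover-edge {t} {u} {v} u∈ v∈ e with cover? t u | cover? t v
  ... | yes Yu | _ = inj₁ Yu
  ... | no _ | yes Yv = inj₂ Yv
  ... | no ¬Yu | no ¬Yv with uncovered u∈ ¬Yu | uncovered v∈ ¬Yv
  ...   | i∈ , u∉ | _ , v∉ with uncovered-apart u∈ ¬Yu v∈ ¬Yv ((inj₁ e , u∉ i∈ , v∉ i∈) ◅ ε)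
  ...     | refl = case trans (sym (irr u)) e of λ ()

  open Refinement (bullet? H) (bullet-sym H) coarse coarse-touch

  -- A component avoiding C_i ∪ X_i for all colours i of the bag attaches to at
  -- most one vertex outside the vertex cover.
  through-unique : ∀ {t u u'} → TopDec.bag coarse t u → ¬ Cover t u → TopDec.bag coarse t u' → ¬ Cover t u' →
                   Through (TopDec.bag coarse t) u u' → u ≡ u'
  through-unique {t} {u} {u'} u∈ ¬Yu u'∈ ¬Yu' (w , w' , e , w∉ , walk , e') with uncovered u∈ ¬Yu | uncovered u'∈ ¬Yu'
  ... | i∈ , u∉ | _ , u'∉ = uncovered-apart u∈ ¬Yu u'∈ ¬Yu'
    ((first e , u∉ i∈ , X∌ w∉) ◅
     Star.map (λ (e , x , y) → restrict e x , X∌ x , X∌ y) walk ◅◅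
     (restrict e' (avoid-end w∉ walk) , X∌ (avoid-end w∉ walk) , u'∉ i∈) ◅ ε)
    where
    X∌ : ∀ {x} → ¬ TopDec.bag coarse t x → ¬ X (col u) x
    X∌ x∉ x∈X = x∉ (col u , inj₂ x∈X , i∈)
    colour≢ : ∀ {x} → ¬ TopDec.bag coarse t x → col x ≢ col u
    colour≢ x∉ col≡ = x∉ (col u , inj₁ col≡ , i∈)
    -- A vertex outside the bag does not have colour `col u`, so its clique edges survive in H^{•∖i}
    -- for this colour.
    restrict : ∀ {x y} → EdgeBullet H x y → ¬ TopDec.bag coarse t x → G (col u) x y
    restrict (inj₁ e) _ = inj₁ e
    restrict (inj₂ (x≢y , col≡)) x∉ = inj₂ (x≢y , col≡ , colour≢ x∉)
    first : EdgeBullet H u w → G (col u) u w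
    first (inj₁ e) = inj₁ e
    first (inj₂ (_ , col≡)) = contradiction (sym col≡) (colour≢ w∉)

  module R = TopDec refined

  BaseCover : Node R.tree → Fin n → Set
  BaseCover x u = ∃[ t ] (base x ≡ just t × Cover t u)

  baseCover? : ∀ x u → Dec (BaseCover x u)
  baseCover? x u with base x
  ... | nothing = no λ { (_ , () , _) }
  ... | just t = map′ (λ Y → t , refl , Y) (λ { (_ , refl , Y) → Y }) (cover? t u)

  baseCover-few : ∀ x → AtMost (vertex-cover-bound c) (BaseCover x)
  baseCover-few x with base x
  ... | nothing = atMost-none λ { (_ , () , _) }
  ... | just t = atMost-mono ℕ.≤-refl (λ { (_ , refl , Y) → Y }) (cover-few t)

  Adhesion : Node R.tree → Fin n → Set
  Adhesion zero u = ⊥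
  Adhesion (suc y) u = R.bag (suc y) u × R.bag (RTree.par R.tree y) u

  adhesion? : ∀ x u → Dec (Adhesion x u)
  adhesion? zero u = no λ ()
  adhesion? (suc y) u = R.bag? (suc y) u ×-dec R.bag? (RTree.par R.tree y) u

  adhesion-unique : ∀ {y u u'} → Adhesion (suc y) u → ¬ BaseCover (RTree.par R.tree y) u →
                    Adhesion (suc y) u' → ¬ BaseCover (RTree.par R.tree y) u' → u ≡ u'
  adhesion-unique {y} (u∈ , u∈p) ¬Yu (u'∈ , u'∈p) ¬Yu' with adhesion {y} u∈ u∈p u'∈ u'∈p
  ... | t , base≡ , u∈t , u'∈t , through =
    through-unique u∈t (λ Y → ¬Yu (t , base≡ , Y)) u'∈t (λ Y → ¬Yu' (t , base≡ , Y)) through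

  adhesion-few : ∀ x → AtMost (suc (vertex-cover-bound c)) (Adhesion x)
  adhesion-few zero = atMost-none λ ()
  adhesion-few (suc y) = atMost-mono (ℕ.≤-reflexive (ℕ.+-comm _ 1)) split
    (atMost-∪ (baseCover-few p) (atMost-unique {P = λ u → Adhesion (suc y) u × ¬ BaseCover p u}
      (λ u → adhesion? (suc y) u ×-dec ¬? (baseCover? p u)) (λ (a , ¬Y) (a' , ¬Y') → adhesion-unique {y} a ¬Y a' ¬Y')))
    where
    p : Node R.tree
    p = RTree.par R.tree y
    split : ∀ {u} → Adhesion (suc y) u → BaseCover p u ⊎ (Adhesion (suc y) u × ¬ BaseCover p u)
    split {u} a with baseCover? p u
    ... | yes Y = inj₁ Y
    ... | no ¬Y = inj₂ (a , ¬Y)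

  Guard : Node R.tree → Fin n → Set
  Guard x u = R.bag x u × (BaseCover x u ⊎ Adhesion x u)

  guard? : ∀ x u → Dec (Guard x u)
  guard? x u = R.bag? x u ×-dec (baseCover? x u ⊎-dec adhesion? x u)

  guard-few : ∀ x → AtMost (guard-bound c) (Guard x)
  guard-few x = atMost-mono ℕ.≤-refl proj₂ (atMost-∪ (baseCover-few x) (adhesion-few x))

  Seen : Node R.tree → Fin k → Set
  Seen x d = ∃[ t ] (base x ≡ just t × ∃[ i ] (bag t i × (d ≡ i ⊎ ∃[ v ] (X i v × d ≡ col v))))

  seen? : ∀ x d → Dec (Seen x d)
  seen? x d with base x
  ... | nothing = no λ { (_ , () , _) }
  ... | just t = map′ (λ s → t , refl , s) (λ { (_ , refl , s) → s })
    (Fin.any? (λ i → bag? t i ×-dec (d Fin.≟ i ⊎-dec Fin.any? (λ v → X? i v ×-dec d Fin.≟ col v))))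

  seen-few : ∀ x → AtMost (colour-bound c) (Seen x)
  seen-few x with base x
  ... | nothing = atMost-none λ { (_ , () , _) }
  ... | just t = atMost-mono ℕ.≤-refl (λ { (_ , refl , s) → s })
    (atMost-⋃ (small t) λ i → atMost-∪ (atMost-point i) (atMost-⋃₁ (few i) λ v → atMost-point (col v)))

  seen : ∀ {x v} → R.bag x v → Seen x (col v)
  seen {x} {v} v∈ with refined⊆ {x} v∈
  ... | t , base≡ , i , inj₁ refl , i∈ = t , base≡ , i , i∈ , inj₁ refl
  ... | t , base≡ , i , inj₂ v∈X , i∈ = t , base≡ , i , i∈ , inj₂ (v , v∈X , refl)

  guardedDec : GuardedDec H (guard-bound c + colour-bound c)
  guardedDec = record
    { dec = dec
    ; g = λ x → ⟪ guard? x ⟫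
    ; σ⊆g = σ⊆g
    ; g⊆β = λ x v∈ → ∈⟪⟫⁺ (R.bag? x) (proj₁ (∈⟪⟫⁻ (guard? x) v∈))
    ; vc = vc
    ; cutv = cutv
    ; guard = λ x → ℕ.≤-trans (∣⟪⟫∣≤ (guard? x) (guard-few x)) (ℕ.m≤m+n _ _)
    ; colors = λ x → ⟪ seen? x ⟫ , ℕ.≤-trans (∣⟪⟫∣≤ (seen? x) (seen-few x)) (ℕ.m≤n+m _ _) ,
        λ v v∈ → ∈⟪⟫⁺ (seen? x) (seen {x} (∈⟪⟫⁻ (R.bag? x) v∈))
    }
    where
    dec : TreeDec n (EdgeBullet H)
    dec = R.toTreeDec λ u v → refined-touch
    β : Node R.tree → Subset n
    β x = ⟪ R.bag? x ⟫
    σ : Node R.tree → Subset n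
    σ = sigma R.tree β
    σ⇒adhesion : ∀ x {u} → u ∈ˢ σ x → Adhesion x u
    σ⇒adhesion zero u∈ = contradiction u∈ Subset.∉⊥
    σ⇒adhesion (suc y) u∈ with Subset.x∈p∩q⁻ (β (suc y)) (β (RTree.par R.tree y)) u∈
    ... | u∈' , u∈p = ∈⟪⟫⁻ (R.bag? (suc y)) u∈' , ∈⟪⟫⁻ (R.bag? (RTree.par R.tree y)) u∈p
    σ⊆g : ∀ x → σ x ⊆ˢ ⟪ guard? x ⟫
    σ⊆g zero u∈ = contradiction u∈ Subset.∉⊥
    σ⊆g (suc y) u∈ = ∈⟪⟫⁺ (guard? (suc y)) (proj₁ (σ⇒adhesion (suc y) u∈) , inj₂ (σ⇒adhesion (suc y) u∈))
    vc : ∀ x u v → u ∈ˢ β x → v ∈ˢ β x → Edge H u v → u ∈ˢ ⟪ guard? x ⟫ ⊎ v ∈ˢ ⟪ guard? x ⟫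
    vc x u v u∈ v∈ e = covered (refined⊆ {x} u∈') (refined⊆ {x} v∈')
      where
      u∈' : R.bag x u
      u∈' = ∈⟪⟫⁻ (R.bag? x) u∈
      v∈' : R.bag x v
      v∈' = ∈⟪⟫⁻ (R.bag? x) v∈
      covered : ∃[ t ] (base x ≡ just t × TopDec.bag coarse t u) → ∃[ t ] (base x ≡ just t × TopDec.bag coarse t v) →
                u ∈ˢ ⟪ guard? x ⟫ ⊎ v ∈ˢ ⟪ guard? x ⟫
      covered (t , base≡ , u∈t) (t' , base≡' , v∈t) with Maybe.just-injective (trans (sym base≡) base≡')
      ... | refl with cover-edge u∈t v∈t e
      ...   | inj₁ Yu = inj₁ (∈⟪⟫⁺ (guard? x) (u∈' , inj₁ (t , base≡ , Yu)))
      ...   | inj₂ Yv = inj₂ (∈⟪⟫⁺ (guard? x) (v∈' , inj₁ (t , base≡ , Yv)))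
    cutv : ∀ y → ∣ σ (suc y) ─ ⟪ guard? (RTree.par R.tree y) ⟫ ∣ ≤ 1
    cutv y = atMost⇒∣∣≤ _ (atMost-unique (Subset._∈? _) λ u∈ v∈ →
      adhesion-unique {y} (adheres u∈) (uncovers u∈) (adheres v∈) (uncovers v∈))
      where
      p : Node R.tree
      p = RTree.par R.tree y
      adheres : ∀ {u} → u ∈ˢ σ (suc y) ─ ⟪ guard? p ⟫ → Adhesion (suc y) u
      adheres u∈ = σ⇒adhesion (suc y) (Subset.p─q⊆p (σ (suc y)) ⟪ guard? p ⟫ u∈)
      uncovers : ∀ {u} → u ∈ˢ σ (suc y) ─ ⟪ guard? p ⟫ → ¬ BaseCover p u
      uncovers u∈ Y = ∉-─ u∈ (∈⟪⟫⁺ (guard? p) (proj₂ (adheres u∈) , inj₁ Y))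

-- The three implications for a class of colored graphs

twAtMost-mono : ∀ {n E c d} → c ≤ d → TwAtMost n E c → TwAtMost n E d
twAtMost-mono c≤d (D , small) = D , λ t → ℕ.≤-trans (small t) (s≤s c≤d)

spasm⇒flower : (𝓗 : CGraph → Set) → Cond1 𝓗 → Cond2 𝓗
spasm⇒flower 𝓗 (c , bounded) = q * q , λ H H∈ →
  twAtMost-mono (ℕ.≤-trans (s≤s (ℕ.m≤n+m c 2)) (ℕ.m≤m*n q q)) (hat-treewidth H (bounded H H∈)) ,
  λ i flower → ℕ.1+n≰n (flower-bound H (bounded H H∈) flower)
  where
  q : ℕ
  -- One more than the bound `2 + c` of `flower-bound`; moreover `q * q` is at least the width
  -- `suc c` from `hat-treewidth`.
  q = 3 + c

flower⇒guarded : (𝓗 : CGraph → Set) → Cond2 𝓗 → Cond3 𝓗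
flower⇒guarded 𝓗 (c , bounded) = guard-bound c + colour-bound c , λ H H∈ → decompose H (bounded H H∈)
  where
  decompose : ∀ H → TwAtMost (CGraph.k H) (HatEdge H) c × (∀ i → ¬ Flower H c i) → GuardedDec H (guard-bound c + colour-bound c)
  decompose H ((TD , small) , flowerless) = GuardedDecomposition.guardedDec H (fromTreeDec TD)
    (λ t → ∣∣≤⇒atMost _ (small t)) (touch-col H (fromTreeDec TD) (λ t → ∣∣≤⇒atMost _ (small t)) (TreeDec.ecover TD _ _))
    (λ i → flowerless⇒separator H (fromTreeDec TD) (λ t → ∣∣≤⇒atMost _ (small t)) (TreeDec.ecover TD _ _) i (flowerless i))

guarded⇒spasm : (𝓗 : CGraph → Set) → Cond3 𝓗 → Cond1 𝓗
guarded⇒spasm 𝓗 (c , guarded) = c , λ H H∈ → spasm-treewidth H (guarded H H∈)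

theorem6p2 : (𝓗 : CGraph → Set) → (Cond1 𝓗 ⇔ Cond2 𝓗) × (Cond2 𝓗 ⇔ Cond3 𝓗)
theorem6p2 𝓗 =
  mk⇔ (spasm⇒flower 𝓗) (guarded⇒spasm 𝓗 ∘ flower⇒guarded 𝓗) ,
  mk⇔ (flower⇒guarded 𝓗) (spasm⇒flower 𝓗 ∘ guarded⇒spasm 𝓗)
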